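{- Let $G$ be the disjointness graph of a finite arrangement of (possibly self-intersecting) $2$-way infinite polygonal $3$-chains in the plane. Then $\chi(G)\le(\omega(G))^3+\omega(G)$.
   Context: A $2$-way infinite polygonal $3$-chain is a continuous curve in the plane consisting of a half-line, a straight-line segment, and another half-line, consecutive pieces sharing an endpoint. The disjointness graph of a family of sets is the graph whose vertices are the sets, two being adjacent if and only if they are disjoint. $\chi(G)$ and $\omega(G)$ denote the chromatic number and clique number of $G$. -}

module Defs where

open import Level using (0ℓ)
open import Data.Nat using (ℕ; suc; _+_; _^_)
open import Data.Fin using (Fin)
open import Data.Product using (Σ; ∃; _×_; _,_)
open import Data.Sum using (_⊎_)
open import Relation.Nullary using (¬_)
open import Relation.Binary.Core using (Rel)
open import Relation.Binary.Definitions using (Decidable)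
open import Relation.Binary.Structures using (IsTotalOrder)
open import Relation.Binary.PropositionalEquality using (_≡_)
open import Algebra.Structures using (IsCommutativeRing)

-- The real numbers, axiomatised as a Dedekind-complete ordered field
-- (unique up to isomorphism; every model is "the" ℝ).  Order is decidable
-- (classically true of ℝ).
record RealField : Set₁ where
  infixl 6 _+ᵣ_
  infixl 7 _*ᵣ_
  field
    Carrier : Set
    _+ᵣ_ _*ᵣ_ : Carrier → Carrier → Carrier
    -ᵣ_ : Carrier → Carrier
    0ᵣ 1ᵣ : Carrier
    isCommutativeRing : IsCommutativeRing _≡_ _+ᵣ_ _*ᵣ_ -ᵣ_ 0ᵣ 1ᵣ
    0≢1 : ¬ (0ᵣ ≡ 1ᵣ)
    inverse : ∀ x → ¬ (x ≡ 0ᵣ) → ∃ λ y → x *ᵣ y ≡ 1ᵣ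
    _≤ᵣ_ : Rel Carrier 0ℓ
    isTotalOrder : IsTotalOrder _≡_ _≤ᵣ_
    _≤ᵣ?_ : Decidable _≤ᵣ_
    +-mono-≤ : ∀ x y z → x ≤ᵣ y → (x +ᵣ z) ≤ᵣ (y +ᵣ z)
    *-nonneg : ∀ x y → 0ᵣ ≤ᵣ x → 0ᵣ ≤ᵣ y → 0ᵣ ≤ᵣ (x *ᵣ y)
    complete : (S : Carrier → Set) → (∃ λ x → S x) →
               (∃ λ b → ∀ x → S x → x ≤ᵣ b) →
               ∃ λ s → (∀ x → S x → x ≤ᵣ s) ×
                       (∀ b → (∀ x → S x → x ≤ᵣ b) → s ≤ᵣ b)

module Plane (ℝ : RealField) where
  open RealField ℝ

  Point : Set
  Point = Carrier × Carrier

  _⊕_ : Point → Point → Point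
  (x₁ , y₁) ⊕ (x₂ , y₂) = (x₁ +ᵣ x₂ , y₁ +ᵣ y₂)

  _⊖_ : Point → Point → Point
  (x₁ , y₁) ⊖ (x₂ , y₂) = (x₁ +ᵣ (-ᵣ x₂) , y₁ +ᵣ (-ᵣ y₂))

  _·_ : Carrier → Point → Point
  t · (x , y) = (t *ᵣ x , t *ᵣ y)

  origin : Point
  origin = (0ᵣ , 0ᵣ)

  -- A 2-way infinite polygonal 3-chain: half-line from a in direction u,
  -- segment [a,b] (nondegenerate), half-line from b in direction v.
  record Chain3 : Set where
    field
      a b u v : Point
      a≢b : ¬ (a ≡ b)
      u≢0 : ¬ (u ≡ origin)
      v≢0 : ¬ (v ≡ origin)

  OnChain : Chain3 → Point → Set
  OnChain c p =
      (∃ λ t → (0ᵣ ≤ᵣ t) × (p ≡ a ⊕ (t · u)))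
    ⊎ (∃ λ t → (0ᵣ ≤ᵣ t) × (t ≤ᵣ 1ᵣ) × (p ≡ a ⊕ (t · (b ⊖ a))))
    ⊎ (∃ λ t → (0ᵣ ≤ᵣ t) × (p ≡ b ⊕ (t · v)))
    where open Chain3 c

  Disjoint : Chain3 → Chain3 → Set
  Disjoint c d = ¬ (∃ λ p → OnChain c p × OnChain d p)

HasClique : ∀ {n} → (Fin n → Fin n → Set) → ℕ → Set
HasClique {n} E m =
  Σ (Fin m → Fin n) λ f →
    (∀ i j → f i ≡ f j → i ≡ j) × (∀ i j → ¬ (i ≡ j) → E (f i) (f j))

Colourable : ∀ {n} → (Fin n → Fin n → Set) → ℕ → Set
Colourable {n} E k =
  Σ (Fin n → Fin k) λ c → ∀ i j → E i j → ¬ (c i ≡ c j)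

DisjGraph : (ℝ : RealField) → ∀ {n} → (Fin n → Plane.Chain3 ℝ) → Fin n → Fin n → Set
DisjGraph ℝ C i j = Plane.Disjoint ℝ (C i) (C j)

{-# OPTIONS --safe #-}
module Submission where

-- After a generic shear no piece of a chain is vertical, so every piece is part of the graph of an affine
-- function.  If the two half-lines of a chain point to different sides, the chain separates the plane; for
-- disjoint chains of this kind "below" is a partial order, and heights in it give ω colours.  If both
-- half-lines point to the same side, the chain is a union of two graphs over a half-line that share the
-- endpoint.  For such chains three partial orders (below, above, and nested, with a suitable order of the
-- domains) relate any two disjoint ones, and a triple of heights gives ω³ colours.  Related chains are
-- disjoint, so the chains of each order are cliques and all heights are less than ω.

-- Three orders relate disjoint bends because a bend has a single point over its own apex: against
-- the two branches of another bend that point is above both, below both or between them, and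
-- connectedness carries this position along the common domain. The obstacle is transitivity: bends
-- over disjoint domains are vacuously below each other, so "below" is paired with an order of the
-- domains under which a middle bend is present wherever the outer two are. For transversals the
-- obstacle is separation: they may turn back and cross themselves, so their sides are written down
-- explicitly before connectedness can be applied. Bends and transversals use separate palettes,
-- whence the sum in the bound. The logic is constructive, yet heights need decisions about
-- relations that quantify over all points; the decidable order and completeness supply them.

open import Defs
open import Algebra.Bundles using (CommutativeRing; RawRing)
import Algebra.Properties.AbelianGroup
import Algebra.Properties.CommutativeSemigroup
import Algebra.Properties.Ring
import Algebra.Properties.Semiring.Mult
import Algebra.Solver.Ring
open import Algebra.Solver.Ring.AlmostCommutativeRing using (fromCommutativeRing; _-Raw-AlmostCommutative⟶_)
open import Data.Bool using (Bool; true; false)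
open import Data.Empty using (⊥; ⊥-elim)
open import Data.Fin using (Fin; zero; suc; fromℕ<; combine; join; splitAt)
open import Data.Fin.Properties using (any?; fromℕ<-injective; combine-injective; splitAt-join)
  renaming (_≟_ to _≟ᶠ_)
open import Data.Maybe using (Maybe; just; nothing)
open import Data.Nat as ℕ using (ℕ; zero; suc; _^_)
import Data.Nat.Properties as ℕₚ
open import Data.Product using (∃; _×_; _,_; proj₁; proj₂)
open import Data.Sum using (_⊎_; inj₁; inj₂; [_,_]′)
open import Data.Sum.Properties using (inj₁-injective; inj₂-injective)
open import Data.Unit using (⊤; tt)
open import Relation.Binary.Definitions using (Decidable; Symmetric; Transitive)
open import Relation.Binary.PropositionalEquality
  using (_≡_; _≢_; refl; sym; trans; cong; cong₂; subst; subst₂; module ≡-Reasoning)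
open import Relation.Binary.Structures using (IsTotalOrder)
open import Relation.Nullary using (¬_; Dec; yes; no; contradiction; Stable)
open import Relation.Nullary.Decidable using (decidable-stable; _×-dec_; _⊎-dec_; ¬?)

-- A ring solver with integer coefficients

module Solver {c ℓ} (R : CommutativeRing c ℓ) where
  open CommutativeRing R
    using (+-congˡ; +-cong; -‿cong; +-identityʳ; -‿inverseʳ;
           +-comm; distribˡ; distribʳ; 0#; 1#; _≈_; ring; semiring; setoid;
           +-commutativeSemigroup; +-abelianGroup)
    renaming (_+_ to _⊞_; _*_ to _⊠_; -_ to ⊟_; sym to ≈-sym; refl to ≈-refl; trans to ≈-trans; *-cong to ⊠-cong)
  open Algebra.Properties.Ring ring using (-‿distribˡ-*; -‿distribʳ-*; -‿involutive; -0#≈0#)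
  open Algebra.Properties.AbelianGroup +-abelianGroup using (⁻¹-∙-comm)
  open Algebra.Properties.CommutativeSemigroup +-commutativeSemigroup using (interchange)
  open Algebra.Properties.Semiring.Mult semiring using (×-homo-+; ×1-homo-*) renaming (_×_ to _⋆_)
  open import Relation.Binary.Reasoning.Setoid setoid

  reduce : ℕ × ℕ → ℕ × ℕ
  reduce (a , b) = (a ℕ.∸ b , b ℕ.∸ a)

  -- Coefficients are formal differences m − n of naturals, kept in lowest terms:
  -- unlike elements of R they compute.
  Coefficients : RawRing _ _
  Coefficients = record
    { Carrier = ℕ × ℕ
    ; _≈_ = _≡_
    ; _+_ = λ (a , b) (c , d) → reduce (a ℕ.+ c , b ℕ.+ d)
    ; _*_ = λ (a , b) (c , d) → reduce (a ℕ.* c ℕ.+ b ℕ.* d , a ℕ.* d ℕ.+ b ℕ.* c)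
    ; -_ = λ (a , b) → (b , a)
    ; 0# = (0 , 0)
    ; 1# = (1 , 0)
    }

  private
    ν : ℕ → _
    ν n = n ⋆ 1#

    sub-+ : ∀ p q r s → (p ⊞ r) ⊞ ⊟ (q ⊞ s) ≈ (p ⊞ ⊟ q) ⊞ (r ⊞ ⊟ s)
    sub-+ p q r s = begin
      (p ⊞ r) ⊞ ⊟ (q ⊞ s)     ≈⟨ +-congˡ (≈-sym (⁻¹-∙-comm q s)) ⟩
      (p ⊞ r) ⊞ (⊟ q ⊞ ⊟ s)   ≈⟨ interchange p r (⊟ q) (⊟ s) ⟩
      (p ⊞ ⊟ q) ⊞ (r ⊞ ⊟ s)   ∎

    sub-* : ∀ p q r s →
      (p ⊠ r ⊞ q ⊠ s) ⊞ ⊟ (p ⊠ s ⊞ q ⊠ r) ≈ (p ⊞ ⊟ q) ⊠ (r ⊞ ⊟ s)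
    sub-* p q r s = begin
      (p ⊠ r ⊞ q ⊠ s) ⊞ ⊟ (p ⊠ s ⊞ q ⊠ r)
        ≈⟨ +-congˡ (-‿cong (+-comm (p ⊠ s) (q ⊠ r))) ⟩
      (p ⊠ r ⊞ q ⊠ s) ⊞ ⊟ (q ⊠ r ⊞ p ⊠ s)
        ≈⟨ sub-+ (p ⊠ r) (q ⊠ r) (q ⊠ s) (p ⊠ s) ⟩
      (p ⊠ r ⊞ ⊟ (q ⊠ r)) ⊞ (q ⊠ s ⊞ ⊟ (p ⊠ s))
        ≈⟨ +-cong (+-congˡ (-‿distribˡ-* q r)) (+-comm (q ⊠ s) _) ⟩
      (p ⊠ r ⊞ ⊟ q ⊠ r) ⊞ (⊟ (p ⊠ s) ⊞ q ⊠ s)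
        ≈⟨ +-cong (≈-sym (distribʳ r p (⊟ q))) (+-cong (-‿distribʳ-* p s) neg-neg) ⟩
      (p ⊞ ⊟ q) ⊠ r ⊞ (p ⊠ ⊟ s ⊞ ⊟ q ⊠ ⊟ s)
        ≈⟨ +-congˡ (≈-sym (distribʳ (⊟ s) p (⊟ q))) ⟩
      (p ⊞ ⊟ q) ⊠ r ⊞ (p ⊞ ⊟ q) ⊠ ⊟ s
        ≈⟨ ≈-sym (distribˡ (p ⊞ ⊟ q) r (⊟ s)) ⟩
      (p ⊞ ⊟ q) ⊠ (r ⊞ ⊟ s) ∎
      where
      neg-neg : q ⊠ s ≈ ⊟ q ⊠ ⊟ s
      neg-neg = begin
        q ⊠ s           ≈⟨ ≈-sym (-‿involutive (q ⊠ s)) ⟩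
        ⊟ (⊟ (q ⊠ s))   ≈⟨ -‿cong (-‿distribʳ-* q s) ⟩
        ⊟ (q ⊠ ⊟ s)     ≈⟨ -‿distribˡ-* q (⊟ s) ⟩
        ⊟ q ⊠ ⊟ s       ∎

    ν-sum : ∀ a c b d → ν (a ℕ.* c ℕ.+ b ℕ.* d) ≈ ν a ⊠ ν c ⊞ ν b ⊠ ν d
    ν-sum a c b d = ≈-trans (×-homo-+ 1# (a ℕ.* c) (b ℕ.* d)) (+-cong (×1-homo-* a c) (×1-homo-* b d))

    -- Padding with the zeros `ν d - ν d` and `ν b - ν b` turns both sides into the same difference
    -- of sums.
    same-difference : ∀ {a b c d} → a ℕ.+ d ≡ c ℕ.+ b → ν a ⊞ ⊟ ν b ≈ ν c ⊞ ⊟ ν d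
    same-difference {a} {b} {c} {d} eq = begin
      ν a ⊞ ⊟ ν b                       ≈⟨ ≈-sym (+-identityʳ _) ⟩
      (ν a ⊞ ⊟ ν b) ⊞ 0#                ≈⟨ +-congˡ (≈-sym (-‿inverseʳ (ν d))) ⟩
      (ν a ⊞ ⊟ ν b) ⊞ (ν d ⊞ ⊟ ν d)     ≈⟨ ≈-sym (sub-+ (ν a) (ν b) (ν d) (ν d)) ⟩
      (ν a ⊞ ν d) ⊞ ⊟ (ν b ⊞ ν d)       ≈⟨ +-cong swapped (-‿cong (+-comm (ν b) (ν d))) ⟩
      (ν c ⊞ ν b) ⊞ ⊟ (ν d ⊞ ν b)       ≈⟨ sub-+ (ν c) (ν d) (ν b) (ν b) ⟩
      (ν c ⊞ ⊟ ν d) ⊞ (ν b ⊞ ⊟ ν b)     ≈⟨ +-congˡ (-‿inverseʳ (ν b)) ⟩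
      (ν c ⊞ ⊟ ν d) ⊞ 0#                ≈⟨ +-identityʳ _ ⟩
      ν c ⊞ ⊟ ν d                       ∎
      where
      swapped : ν a ⊞ ν d ≈ ν c ⊞ ν b
      swapped = ≈-trans (≈-sym (×-homo-+ 1# a d))
        (≈-trans (CommutativeRing.reflexive R (cong ν eq)) (×-homo-+ 1# c b))

    -- The special cases let numerals 0 and 1 denote 0# and 1# definitionally.
    value : ℕ × ℕ → CommutativeRing.Carrier R
    value (0 , 0) = 0#
    value (1 , 0) = 1#
    value (a , b) = ν a ⊞ ⊟ ν b

    value≈ : ∀ a b → value (a , b) ≈ ν a ⊞ ⊟ ν b
    value≈ 0 0 = ≈-sym (-‿inverseʳ 0#)
    value≈ 1 0 = ≈-sym (≈-trans (+-cong (+-identityʳ 1#) -0#≈0#) (+-identityʳ 1#))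
    value≈ 0 (suc b) = ≈-refl
    value≈ 1 (suc b) = ≈-refl
    value≈ (suc (suc a)) b = ≈-refl

    value-reduce : ∀ a b → value (reduce (a , b)) ≈ ν a ⊞ ⊟ ν b
    value-reduce a b = ≈-trans (value≈ (a ℕ.∸ b) (b ℕ.∸ a))
      (same-difference {a ℕ.∸ b} {b ℕ.∸ a} {a} {b} (∸-balance a b))
      where
      ∸-balance : ∀ a b → (a ℕ.∸ b) ℕ.+ b ≡ a ℕ.+ (b ℕ.∸ a)
      ∸-balance zero zero = refl
      ∸-balance zero (suc b) = refl
      ∸-balance (suc a) zero = refl
      ∸-balance (suc a) (suc b) = trans (ℕₚ.+-suc (a ℕ.∸ b) b) (cong suc (∸-balance a b))

  difference : Coefficients -Raw-AlmostCommutative⟶ fromCommutativeRing R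
  difference = record
    { ⟦_⟧ = value
    ; +-homo = λ (a , b) (c , d) → begin
        value (reduce (a ℕ.+ c , b ℕ.+ d))    ≈⟨ value-reduce (a ℕ.+ c) (b ℕ.+ d) ⟩
        ν (a ℕ.+ c) ⊞ ⊟ ν (b ℕ.+ d)           ≈⟨ +-cong (×-homo-+ 1# a c) (-‿cong (×-homo-+ 1# b d)) ⟩
        (ν a ⊞ ν c) ⊞ ⊟ (ν b ⊞ ν d)           ≈⟨ sub-+ (ν a) (ν b) (ν c) (ν d) ⟩
        (ν a ⊞ ⊟ ν b) ⊞ (ν c ⊞ ⊟ ν d)         ≈⟨ ≈-sym (+-cong (value≈ a b) (value≈ c d)) ⟩
        value (a , b) ⊞ value (c , d)         ∎
    ; *-homo = λ (a , b) (c , d) → begin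
        value (reduce (a ℕ.* c ℕ.+ b ℕ.* d , a ℕ.* d ℕ.+ b ℕ.* c))
          ≈⟨ value-reduce (a ℕ.* c ℕ.+ b ℕ.* d) (a ℕ.* d ℕ.+ b ℕ.* c) ⟩
        ν (a ℕ.* c ℕ.+ b ℕ.* d) ⊞ ⊟ ν (a ℕ.* d ℕ.+ b ℕ.* c)
          ≈⟨ +-cong (ν-sum a c b d) (-‿cong (ν-sum a d b c)) ⟩
        (ν a ⊠ ν c ⊞ ν b ⊠ ν d) ⊞ ⊟ (ν a ⊠ ν d ⊞ ν b ⊠ ν c)
          ≈⟨ sub-* (ν a) (ν b) (ν c) (ν d) ⟩
        (ν a ⊞ ⊟ ν b) ⊠ (ν c ⊞ ⊟ ν d)
          ≈⟨ ≈-sym (⊠-cong (value≈ a b) (value≈ c d)) ⟩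
        value (a , b) ⊠ value (c , d) ∎
    ; -‿homo = λ (a , b) → begin
        value (b , a)                ≈⟨ value≈ b a ⟩
        ν b ⊞ ⊟ ν a                  ≈⟨ +-comm (ν b) (⊟ ν a) ⟩
        ⊟ ν a ⊞ ν b                  ≈⟨ +-congˡ (≈-sym (-‿involutive (ν b))) ⟩
        ⊟ ν a ⊞ ⊟ (⊟ ν b)            ≈⟨ ⁻¹-∙-comm (ν a) (⊟ ν b) ⟩
        ⊟ (ν a ⊞ ⊟ ν b)              ≈⟨ -‿cong (≈-sym (value≈ a b)) ⟩
        ⊟ value (a , b)              ∎
    ; 0-homo = ≈-refl
    ; 1-homo = ≈-refl
    }

  private
    -- Distinct integers may coincide in `R`; answering `nothing` for them is sound, because the
    -- solver trusts only positive answers.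
    equal? : ∀ p q → Maybe (value p ≈ value q)
    equal? (a , b) (c , d) with a ℕ.+ d ℕ.≟ c ℕ.+ b
    ... | yes eq = just (≈-trans (value≈ a b) (≈-trans (same-difference {a} {b} {c} {d} eq) (≈-sym (value≈ c d))))
    ... | no _ = nothing

  open Algebra.Solver.Ring Coefficients (fromCommutativeRing R) difference equal? public

-- Ordered field arithmetic, decisions from completeness, connectedness, lines

module OrderedField (ℝ : RealField) where
  open RealField ℝ public
    using (isCommutativeRing; 0≢1; inverse; isTotalOrder; *-nonneg; complete)
    renaming (Carrier to R; _+ᵣ_ to _+_; _*ᵣ_ to _*_; -ᵣ_ to infix 8 -_; 0ᵣ to 0#; 1ᵣ to 1#;
              _≤ᵣ_ to infix 4 _≤_; _≤ᵣ?_ to infix 4 _≤?_; +-mono-≤ to +-monoˡ)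
  open IsTotalOrder isTotalOrder public
    using () renaming (refl to ≤-refl; trans to ≤-trans; antisym to ≤-antisym; total to ≤-total;
                       reflexive to ≤-reflexive)

  commutativeRing : CommutativeRing _ _
  commutativeRing = record { isCommutativeRing = isCommutativeRing }

  open CommutativeRing commutativeRing public using (+-assoc)
  open Solver commutativeRing public using (solve; con; _:+_; _:*_; :-_; _:-_; _:=_)

  infix 4 _<_

  -- For a decidable total order this is the usual strict order. As a negation it is stable, and so
  -- are statements such as `Below` and `_⊏_` that conclude with it.
  _<_ : R → R → Set
  x < y = ¬ (y ≤ x)

  <⇒≤ : ∀ {x y} → x < y → x ≤ y
  <⇒≤ {x} {y} x<y = [ (λ p → p) , (λ q → contradiction q x<y) ]′ (≤-total x y)

  <-irrefl : ∀ {x} → ¬ (x < x)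
  <-irrefl x<x = x<x ≤-refl

  ≤-<-trans : ∀ {x y z} → x ≤ y → y < z → x < z
  ≤-<-trans x≤y y<z z≤x = y<z (≤-trans z≤x x≤y)

  <-≤-trans : ∀ {x y z} → x < y → y ≤ z → x < z
  <-≤-trans x<y y≤z z≤x = x<y (≤-trans y≤z z≤x)

  <-trans : ∀ {x y z} → x < y → y < z → x < z
  <-trans x<y y<z = <-≤-trans x<y (<⇒≤ y<z)

  ≤-stable : ∀ {x y} → Stable (x ≤ y)
  ≤-stable {x} {y} = decidable-stable (x ≤? y)

  <-cmp : ∀ x y → x < y ⊎ x ≡ y ⊎ y < x
  <-cmp x y with y ≤? x | x ≤? y
  ... | no x<y | _ = inj₁ x<y
  ... | yes _ | no y<x = inj₂ (inj₂ y<x)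
  ... | yes y≤x | yes x≤y = inj₂ (inj₁ (≤-antisym x≤y y≤x))

  ≤⇒<⊎≡ : ∀ {x y} → x ≤ y → x < y ⊎ x ≡ y
  ≤⇒<⊎≡ {x} {y} x≤y with <-cmp x y
  ... | inj₁ x<y = inj₁ x<y
  ... | inj₂ (inj₁ x≡y) = inj₂ x≡y
  ... | inj₂ (inj₂ y<x) = contradiction x≤y y<x

  <-or-≤ : ∀ x y → x < y ⊎ y ≤ x
  <-or-≤ x y with y ≤? x
  ... | yes y≤x = inj₂ y≤x
  ... | no x<y = inj₁ x<y

  ∃-max : ∀ x y → ∃ λ z → x ≤ z × y ≤ z × (∀ {w} → x < w → y < w → z < w)
  ∃-max x y with ≤-total x y
  ... | inj₁ x≤y = y , x≤y , ≤-refl , λ _ y<w → y<w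
  ... | inj₂ y≤x = x , ≤-refl , y≤x , λ x<w _ → x<w

  ∃-min : ∀ x y → ∃ λ z → z ≤ x × z ≤ y × (∀ {w} → w < x → w < y → w < z)
  ∃-min x y with ≤-total x y
  ... | inj₁ x≤y = x , ≤-refl , x≤y , λ w<x _ → w<x
  ... | inj₂ y≤x = y , y≤x , ≤-refl , λ _ w<y → w<y

  ≤⇒0≤- : ∀ {x y} → x ≤ y → 0# ≤ y + - x
  ≤⇒0≤- {x} {y} x≤y =
    subst (_≤ y + - x) (solve 1 (λ x → x :+ :- x := con (0 , 0)) refl x) (+-monoˡ x y (- x) x≤y)

  0≤-⇒≤ : ∀ {x y} → 0# ≤ y + - x → x ≤ y
  0≤-⇒≤ {x} {y} 0≤ = subst₂ _≤_
    (solve 1 (λ x → con (0 , 0) :+ x := x) refl x)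
    (solve 2 (λ x y → (y :+ :- x) :+ x := y) refl x y)
    (+-monoˡ 0# (y + - x) x 0≤)

  <⇒0<- : ∀ {x y} → x < y → 0# < y + - x
  <⇒0<- {x} {y} x<y y-x≤0 = x<y (0≤-⇒≤ (subst (0# ≤_)
    (solve 2 (λ x y → con (0 , 0) :+ :- (y :+ :- x) := x :+ :- y) refl x y) (≤⇒0≤- y-x≤0)))

  0<-⇒< : ∀ {x y} → 0# < y + - x → x < y
  0<-⇒< {x} {y} 0< y≤x = 0< (0≤-⇒≤ (subst (0# ≤_)
    (solve 2 (λ x y → x :+ :- y := con (0 , 0) :+ :- (y :+ :- x)) refl x y) (≤⇒0≤- y≤x)))

  neg-nonneg : ∀ {x} → x ≤ 0# → 0# ≤ - x
  neg-nonneg {x} x≤0 =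
    subst (0# ≤_) (solve 1 (λ x → con (0 , 0) :+ :- x := :- x) refl x) (≤⇒0≤- x≤0)

  neg-nonpos : ∀ {x} → 0# ≤ - x → x ≤ 0#
  neg-nonpos {x} 0≤-x =
    0≤-⇒≤ (subst (0# ≤_) (solve 1 (λ x → :- x := con (0 , 0) :+ :- x) refl x) 0≤-x)

  pos-factorˡ : ∀ {x y} → 0# < x * y → 0# < y → 0# < x
  pos-factorˡ {x} {y} 0<xy 0<y x≤0 = 0<xy (neg-nonpos (subst (0# ≤_)
    (solve 2 (λ x y → (:- x) :* y := :- (x :* y)) refl x y)
    (*-nonneg (- x) y (neg-nonneg x≤0) (<⇒≤ 0<y))))

  0<1 : 0# < 1#
  0<1 1≤0 = 0≢1 (≤-antisym (subst (0# ≤_) (solve 0 (:- con (1 , 0) :* :- con (1 , 0) := con (1 , 0)) refl)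
    (*-nonneg (- 1#) (- 1#) (neg-nonneg 1≤0) (neg-nonneg 1≤0))) 1≤0)

  x<x+1 : ∀ x → x < x + 1#
  x<x+1 x = 0<-⇒< (subst (0# <_) (solve 1 (λ x → con (1 , 0) := (x :+ con (1 , 0)) :+ :- x) refl x) 0<1)

  x-1<x : ∀ x → x + - 1# < x
  x-1<x x = 0<-⇒< (subst (0# <_) (solve 1 (λ x → con (1 , 0) := x :+ :- (x :+ :- con (1 , 0))) refl x) 0<1)

  x<x+pos : ∀ {x y} → 0# < y → x < x + y
  x<x+pos {x} {y} 0<y = 0<-⇒< (subst (0# <_) (solve 2 (λ x y → y := (x :+ y) :+ :- x) refl x y) 0<y)

  x+neg<x : ∀ {x y z} → y < z → x + (y + - z) < x
  x+neg<x {x} {y} {z} y<z = 0<-⇒< (subst (0# <_)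
    (solve 3 (λ x y z → z :+ :- y := x :+ :- (x :+ (y :+ :- z))) refl x y z) (<⇒0<- y<z))

  cancel : ∀ x y → x + (y + - x) ≡ y
  cancel = solve 2 (λ x y → x :+ (y :+ :- x) := y) refl

  inverse-pos : ∀ {x y} → 0# < x → x * y ≡ 1# → 0# < y
  inverse-pos {x} {y} 0<x xy≡1 = pos-factorˡ
    (subst (0# <_) (sym (trans (solve 2 (λ x y → y :* x := x :* y) refl x y) xy≡1)) 0<1) 0<x

  -- The axioms speak of nonnegative products only. Strictness comes from the positive inverse of
  -- `y`: multiplying `x * y ≤ 0` by it would give `x ≤ 0`.
  *-pos : ∀ {x y} → 0# < x → 0# < y → 0# < x * y
  *-pos {x} {y} 0<x 0<y xy≤0 =
    let i , yi≡1 = inverse y λ y≡0 → 0<y (≤-reflexive y≡0)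
        x≡xyi = begin
          x              ≡⟨ solve 1 (λ x → x := x :* con (1 , 0)) refl x ⟩
          x * 1#         ≡⟨ cong (x *_) (sym yi≡1) ⟩
          x * (y * i)    ≡⟨ solve 3 (λ x y i → x :* (y :* i) := :- ((:- (x :* y)) :* i)) refl x y i ⟩
          - (- (x * y) * i) ∎
        0≤- = *-nonneg _ i (neg-nonneg xy≤0) (<⇒≤ (inverse-pos 0<y yi≡1))
    in 0<x (subst (_≤ 0#) (sym x≡xyi)
         (neg-nonpos (subst (0# ≤_) (solve 1 (λ z → z := :- (:- z)) refl _) 0≤-)))
    where open ≡-Reasoning

  dense : ∀ {x y} → x < y → ∃ λ z → x < z × z < y
  dense {x} {y} x<y =
    z
    , 0<-⇒< (subst (0# <_) (below x y half) 0<d)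
    , 0<-⇒< (subst (0# <_) above 0<d)
    where
    open ≡-Reasoning
    two = 1# + 1#
    0<2 : 0# < two
    0<2 = <-trans 0<1 (x<x+1 1#)
    half = proj₁ (inverse two λ e → 0<2 (≤-reflexive e))
    2half≡1 : two * half ≡ 1#
    2half≡1 = proj₂ (inverse two λ e → 0<2 (≤-reflexive e))
    z = x + (y + - x) * half
    0<d : 0# < (y + - x) * half
    0<d = *-pos (<⇒0<- x<y) (inverse-pos 0<2 2half≡1)
    below : ∀ x y h → (y + - x) * h ≡ (x + (y + - x) * h) + - x
    below = solve 3 (λ x y h → (y :+ :- x) :* h := (x :+ (y :+ :- x) :* h) :+ :- x) refl
    above : (y + - x) * half ≡ y + - z
    above = begin
      (y + - x) * half
        ≡⟨ solve 3 (λ x y h → (y :+ :- x) :* h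
             := (y :+ :- x) :* ((con (1 , 0) :+ con (1 , 0)) :* h) :+ :- ((y :+ :- x) :* h)) refl x y half ⟩
      (y + - x) * (two * half) + - ((y + - x) * half)
        ≡⟨ cong (λ o → (y + - x) * o + - ((y + - x) * half)) 2half≡1 ⟩
      (y + - x) * 1# + - ((y + - x) * half)
        ≡⟨ solve 3 (λ x y h → (y :+ :- x) :* con (1 , 0) :+ :- ((y :+ :- x) :* h)
             := y :+ :- (x :+ (y :+ :- x) :* h)) refl x y half ⟩
      y + - z ∎

  -- Completeness decides negations: the supremum of {0} ∪ {1 | P} is ≤ 0 exactly when P fails.
  ¬-or-¬¬ : (P : Set) → ¬ P ⊎ ¬ ¬ P
  ¬-or-¬¬ P with complete S (0# , inj₁ refl) (1# , bounded)
    where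
    S : R → Set
    S x = x ≡ 0# ⊎ (x ≡ 1# × P)
    bounded : ∀ x → S x → x ≤ 1#
    bounded _ (inj₁ refl) = <⇒≤ 0<1
    bounded _ (inj₂ (refl , _)) = ≤-refl
  ... | s , upper , least with s ≤? 0#
  ... | yes s≤0 = inj₁ λ p → 0<1 (≤-trans (upper 1# (inj₂ (refl , p))) s≤0)
  ... | no 0<s = inj₂ λ ¬p → 0<s (least 0# λ where
    _ (inj₁ refl) → ≤-refl
    _ (inj₂ (_ , p)) → contradiction p ¬p)

  -- This decides relations between whole curves, which cannot be checked point by point but are
  -- stable.
  stable⇒dec : ∀ {P} → Stable P → Dec P
  stable⇒dec {P} stable with ¬-or-¬¬ P
  ... | inj₁ ¬p = no ¬p
  ... | inj₂ ¬¬p = yes (stable ¬¬p)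

  -- Open sets and continuity

  Open : (R → Set) → Set
  Open P = ∀ x → P x → ∃ λ l → ∃ λ r → l < x × x < r × (∀ z → l < z → z < r → P z)

  Open-∩ : ∀ {P Q} → Open P → Open Q → Open (λ x → P x × Q x)
  Open-∩ oP oQ x (p , q) =
    let l₁ , r₁ , l₁<x , x<r₁ , inP = oP x p
        l₂ , r₂ , l₂<x , x<r₂ , inQ = oQ x q
        l , l₁≤l , l₂≤l , l< = ∃-max l₁ l₂
        r , r≤r₁ , r≤r₂ , <r = ∃-min r₁ r₂
    in l , r , l< l₁<x l₂<x , <r x<r₁ x<r₂ , λ z l<z z<r →
         inP z (≤-<-trans l₁≤l l<z) (<-≤-trans z<r r≤r₁)
       , inQ z (≤-<-trans l₂≤l l<z) (<-≤-trans z<r r≤r₂)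

  Open-∪ : ∀ {P Q} → Open P → Open Q → Open (λ x → P x ⊎ Q x)
  Open-∪ oP oQ x (inj₁ p) =
    let l , r , l<x , x<r , inP = oP x p in l , r , l<x , x<r , λ z l<z z<r → inj₁ (inP z l<z z<r)
  Open-∪ oP oQ x (inj₂ q) =
    let l , r , l<x , x<r , inQ = oQ x q in l , r , l<x , x<r , λ z l<z z<r → inj₂ (inQ z l<z z<r)

  Open-⊆ : ∀ {P Q} → Open P → (∀ {x} → P x → Q x) → (∀ {x} → Q x → P x) → Open Q
  Open-⊆ oP P⊆Q Q⊆P x q =
    let l , r , l<x , x<r , inP = oP x (Q⊆P q) in l , r , l<x , x<r , λ z l<z z<r → P⊆Q (inP z l<z z<r)

  Open-<c : ∀ c → Open (_< c)
  Open-<c c x x<c = x + - 1# , c , x-1<x x , x<c , λ _ _ z<c → z<c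

  Open-c< : ∀ c → Open (c <_)
  Open-c< c x c<x = c , x + 1# , c<x , x<x+1 x , λ _ c<z _ → c<z

  -- At `p` itself both neighbourhoods are intersected, and each side of `p` uses its own predicate.
  -- Working with predicates lets one proof serve both `y <_` and `_< y` of a glued function.
  Open-paste : ∀ {P Q U : R → Set} p → Open P → Open Q →
    (∀ {x} → x ≤ p → P x → U x) → (∀ {x} → x ≤ p → U x → P x) →
    (∀ {x} → p ≤ x → Q x → U x) → (∀ {x} → p ≤ x → U x → Q x) → Open U
  Open-paste p oP oQ P⇒U U⇒P Q⇒U U⇒Q x u with <-cmp x p
  ... | inj₁ x<p =
    let l , r , l<x , x<r , inP = Open-∩ oP (Open-<c p) x (U⇒P (<⇒≤ x<p) u , x<p)
    in l , r , l<x , x<r , λ z l<z z<r → let q , z<p = inP z l<z z<r in P⇒U (<⇒≤ z<p) q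
  ... | inj₂ (inj₂ p<x) =
    let l , r , l<x , x<r , inQ = Open-∩ oQ (Open-c< p) x (U⇒Q (<⇒≤ p<x) u , p<x)
    in l , r , l<x , x<r , λ z l<z z<r → let q , p<z = inQ z l<z z<r in Q⇒U (<⇒≤ p<z) q
  ... | inj₂ (inj₁ refl) =
    let l , r , l<x , x<r , inPQ = Open-∩ oP oQ x (U⇒P ≤-refl u , U⇒Q ≤-refl u)
    in l , r , l<x , x<r , λ z l<z z<r →
         [ (λ z≤p → P⇒U z≤p (proj₁ (inPQ z l<z z<r)))
         , (λ p≤z → Q⇒U p≤z (proj₂ (inPQ z l<z z<r))) ]′ (≤-total z p)

  -- Preimages of open rays suffice, since the rays generate the order topology; no distances
  -- appear.
  Continuous : (R → R) → Set
  Continuous f = (∀ y → Open λ x → y < f x) × (∀ y → Open λ x → f x < y)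

  -- A value `y` strictly between `f x` and `g x` splits the condition into two preimages of rays.
  Open-< : ∀ {f g} → Continuous f → Continuous g → Open (λ x → f x < g x)
  Open-< {f} {g} (_ , f<) (g> , _) x fx<gx =
    let y , fx<y , y<gx = dense fx<gx
        l , r , l<x , x<r , near = Open-∩ (f< y) (g> y) x (fx<y , y<gx)
    in l , r , l<x , x<r , λ z l<z z<r → <-trans (proj₁ (near z l<z z<r)) (proj₂ (near z l<z z<r))

  -- An interval is connected; the witness is the supremum of P ∩ [l, r].
  separate : ∀ {P Q : R → Set} → Open P → Open Q → (∀ x → P x → ¬ Q x) →
    ∀ {l r} → l ≤ r → P l → Q r → ∃ λ x → l ≤ x × x ≤ r × ¬ P x × ¬ Q x
  separate {P} {Q} oP oQ P∩Q {l} {r} l≤r Pl Qr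
    with complete (λ t → (l ≤ t × t ≤ r) × P t) (l , (≤-refl , l≤r) , Pl) (r , λ _ ((_ , t≤r) , _) → t≤r)
  ... | s , upper , least = s , l≤s , s≤r , ¬Ps , ¬Qs
    where
    s≤r : s ≤ r
    s≤r = least r λ _ ((_ , t≤r) , _) → t≤r
    l≤s : l ≤ s
    l≤s = upper l ((≤-refl , l≤r) , Pl)
    ¬Ps : ¬ P s
    ¬Ps Ps with ≤⇒<⊎≡ s≤r
    ... | inj₂ refl = P∩Q s Ps Qr
    -- Openness would extend `P` past `s`; cutting at `c ≤ r` keeps the new point `t` in the
    -- interval, against `s` being an upper bound.
    ... | inj₁ s<r =
      let a , b , a<s , s<b , near = oP s Ps
          c , c≤b , c≤r , <c = ∃-min b r
          t , s<t , t<c = dense (<c s<b s<r)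
      in s<t (upper t ((≤-trans l≤s (<⇒≤ s<t) , ≤-trans (<⇒≤ t<c) c≤r)
                       , near t (<-trans a<s s<t) (<-≤-trans t<c c≤b)))
    ¬Qs : ¬ Q s
    -- A neighbourhood of `s` inside `Q` contains no point of `P`, so its left end would be a
    -- smaller upper bound.
    ¬Qs Qs =
      let a , b , a<s , s<b , near = oQ s Qs
      in a<s (least a λ t ((l≤t , t≤r) , Pt) → ≤-stable λ a<t →
           P∩Q t Pt (near t a<t (≤-<-trans (upper t ((l≤t , t≤r) , Pt)) s<b)))

  Convex : (R → Set) → Set
  Convex I = ∀ {x y z} → I x → I z → x ≤ y → y ≤ z → I y

  -- If `Q` held at `y`, `separate` would find a point between `x` and `y`, hence in `I`, that the
  -- cover misses.
  propagate : ∀ {I P Q : R → Set} → Convex I → Open P → Open Q → (∀ x → P x → ¬ Q x) →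
    (∀ {x} → I x → P x ⊎ Q x) → ∀ {x y} → I x → I y → P x → P y
  propagate convex oP oQ P∩Q cover {x} {y} Ix Iy Px with cover Iy
  ... | inj₁ Py = Py
  ... | inj₂ Qy with ≤-total x y
  ... | inj₁ x≤y =
    let z , x≤z , z≤y , ¬Pz , ¬Qz = separate oP oQ P∩Q x≤y Px Qy
    in ⊥-elim ([ ¬Pz , ¬Qz ]′ (cover (convex Ix Iy x≤z z≤y)))
  ... | inj₂ y≤x =
    let z , y≤z , z≤x , ¬Qz , ¬Pz = separate oQ oP (λ x q p → P∩Q x p q) y≤x Qy Px
    in ⊥-elim ([ ¬Pz , ¬Qz ]′ (cover (convex Iy Ix y≤z z≤x)))

  -- The intermediate value theorem in the form in which curves use it.
  propagate-< : ∀ {I f g} → Convex I → Continuous f → Continuous g → (∀ {x} → I x → f x ≢ g x) →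
    ∀ {x y} → I x → I y → f x < g x → f y < g y
  propagate-< {I} {f} {g} convex cf cg f≢g =
    propagate convex (Open-< cf cg) (Open-< cg cf) (λ _ f<g g<f → <-irrefl (<-trans f<g g<f)) cover
    where
    cover : ∀ {x} → I x → f x < g x ⊎ g x < f x
    cover {x} Ix with <-cmp (f x) (g x)
    ... | inj₁ f<g = inj₁ f<g
    ... | inj₂ (inj₁ f≡g) = contradiction f≡g (f≢g Ix)
    ... | inj₂ (inj₂ g<f) = inj₂ g<f

  glue : R → (R → R) → (R → R) → R → R
  glue p f g x with x ≤? p
  ... | yes _ = f x
  ... | no _ = g x

  glue-≤ : ∀ p f g {x} → x ≤ p → glue p f g x ≡ f x
  glue-≤ p f g {x} x≤p with x ≤? p
  ... | yes _ = refl
  ... | no p<x = contradiction x≤p p<x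

  glue-≥ : ∀ p f g → f p ≡ g p → ∀ {x} → p ≤ x → glue p f g x ≡ g x
  glue-≥ p f g fp≡gp {x} p≤x with x ≤? p
  ... | yes x≤p with refl ← ≤-antisym x≤p p≤x = fp≡gp
  ... | no _ = refl

  glue-continuous : ∀ p f g → f p ≡ g p → Continuous f → Continuous g → Continuous (glue p f g)
  glue-continuous p f g fp≡gp (f> , f<) (g> , g<) =
    (λ y → paste (y <_) (f> y) (g> y)) , (λ y → paste (_< y) (f< y) (g< y))
    where
    paste : (U : R → Set) → Open (λ x → U (f x)) → Open (λ x → U (g x)) → Open (λ x → U (glue p f g x))
    paste U oP oQ = Open-paste p oP oQ
      (λ x≤p → subst U (sym (glue-≤ p f g x≤p))) (λ x≤p → subst U (glue-≤ p f g x≤p))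
      (λ p≤x → subst U (sym (glue-≥ p f g fp≡gp p≤x))) (λ p≤x → subst U (glue-≥ p f g fp≡gp p≤x))

  -- Non-vertical lines y = m x + k

  Line : Set
  Line = R × R

  at : Line → R → R
  at (m , k) x = m * x + k

  rise : ∀ m k x y → m * (y + - x) ≡ at (m , k) y + - at (m , k) x
  rise = solve 4 (λ m k x y → m :* (y :+ :- x) := (m :* y :+ k) :+ :- (m :* x :+ k)) refl

  increasing : ∀ {m} k → 0# < m → ∀ {x y} → x < y → at (m , k) x < at (m , k) y
  increasing {m} k 0<m {x} {y} x<y = 0<-⇒< (subst (0# <_) (rise m k x y) (*-pos 0<m (<⇒0<- x<y)))

  decreasing : ∀ {m} k → m < 0# → ∀ {x y} → x < y → at (m , k) y < at (m , k) x
  decreasing {m} k m<0 {x} {y} x<y = 0<-⇒< (subst (0# <_)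
    (solve 4 (λ m k x y → (con (0 , 0) :+ :- m) :* (y :+ :- x) := (m :* x :+ k) :+ :- (m :* y :+ k)) refl m k x y)
    (*-pos (<⇒0<- m<0) (<⇒0<- x<y)))

  at-surjective : ∀ {m} k → m ≢ 0# → ∀ y → ∃ λ x → at (m , k) x ≡ y
  at-surjective {m} k m≢0 y =
    let i , mi≡1 = inverse m m≢0
    in i * (y + - k) , (begin
      m * (i * (y + - k)) + k    ≡⟨ solve 4 (λ m k i y →
                                      m :* (i :* (y :+ :- k)) :+ k := (m :* i) :* (y :+ :- k) :+ k) refl m k i y ⟩
      (m * i) * (y + - k) + k    ≡⟨ cong (λ o → o * (y + - k) + k) mi≡1 ⟩
      1# * (y + - k) + k         ≡⟨ solve 2 (λ k y → con (1 , 0) :* (y :+ :- k) :+ k := y) refl k y ⟩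
      y ∎)
    where open ≡-Reasoning

  -- For nonzero slope the preimage of a ray is a ray, ending where the line attains the bound; its
  -- side depends on the sign of the slope. For slope zero membership does not depend on `x`.
  line-continuous : ∀ L → Continuous (at L)
  line-continuous (m , k) with <-cmp m 0#
  ... | inj₂ (inj₁ refl) =
    (λ y → constant (y <_)) , (λ y → constant (_< y))
    where
    constant : (U : R → Set) → Open (λ x → U (at (0# , k) x))
    constant U x u = x + - 1# , x + 1# , x-1<x x , x<x+1 x , λ z _ _ →
      subst U (solve 3 (λ k x z → con (0 , 0) :* x :+ k := con (0 , 0) :* z :+ k) refl k x z) u
  ... | inj₂ (inj₂ 0<m) = above , below
    where
    reflect : ∀ {x y} → at (m , k) x < at (m , k) y → x < y
    reflect fx<fy y≤x with ≤⇒<⊎≡ y≤x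
    ... | inj₁ y<x = fx<fy (<⇒≤ (increasing k 0<m y<x))
    ... | inj₂ refl = fx<fy ≤-refl
    m≢0 : m ≢ 0#
    m≢0 e = 0<m (≤-reflexive e)
    above : ∀ y → Open λ x → y < at (m , k) x
    above y = let c , eq = at-surjective k m≢0 y in
      subst (λ y → Open λ x → y < at (m , k) x) eq (Open-⊆ (Open-c< c) (increasing k 0<m) reflect)
    below : ∀ y → Open λ x → at (m , k) x < y
    below y = let c , eq = at-surjective k m≢0 y in
      subst (λ y → Open λ x → at (m , k) x < y) eq (Open-⊆ (Open-<c c) (increasing k 0<m) reflect)
  ... | inj₁ m<0 = above , below
    where
    reflect : ∀ {x y} → at (m , k) x < at (m , k) y → y < x
    reflect fx<fy x≤y with ≤⇒<⊎≡ x≤y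
    ... | inj₁ x<y = fx<fy (<⇒≤ (decreasing k m<0 x<y))
    ... | inj₂ refl = fx<fy ≤-refl
    m≢0 : m ≢ 0#
    m≢0 e = m<0 (≤-reflexive (sym e))
    above : ∀ y → Open λ x → y < at (m , k) x
    above y = let c , eq = at-surjective k m≢0 y in
      subst (λ y → Open λ x → y < at (m , k) x) eq (Open-⊆ (Open-<c c) (decreasing k m<0) reflect)
    below : ∀ y → Open λ x → at (m , k) x < y
    below y = let c , eq = at-surjective k m≢0 y in
      subst (λ y → Open λ x → at (m , k) x < y) eq (Open-⊆ (Open-c< c) (decreasing k m<0) reflect)

  private
    -- Subtracting the difference at `p`, which is zero, cancels the intercepts.
    gap : ∀ K L {p} x → at K p ≡ at L p →
      (proj₁ L + - proj₁ K) * (x + - p) ≡ at L x + - at K x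
    gap K@(m , k) L@(n , l) {p} x Kp≡Lp = begin
      (n + - m) * (x + - p)
        ≡⟨ solve 6 (λ m k n l p x → (n :+ :- m) :* (x :+ :- p)
             := ((n :* x :+ l) :+ :- (m :* x :+ k)) :+ ((m :* p :+ k) :+ :- (n :* p :+ l))) refl m k n l p x ⟩
      (at L x + - at K x) + (at K p + - at L p)
        ≡⟨ cong (λ y → (at L x + - at K x) + (y + - at L p)) Kp≡Lp ⟩
      (at L x + - at K x) + (at L p + - at L p)
        ≡⟨ solve 2 (λ y z → y :+ (z :+ :- z) := y) refl _ _ ⟩
      at L x + - at K x ∎
      where open ≡-Reasoning

    flipped : ∀ u v → (- u) * (- v) ≡ u * v
    flipped = solve 2 (λ u v → :- u :* :- v := u :* v) refl

    cross : ∀ u v → (- u) * v ≡ - (u * v)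
    cross = solve 2 (λ u v → :- u :* v := :- (u :* v)) refl

    neg-diff : ∀ x y → - (x + - y) ≡ y + - x
    neg-diff = solve 2 (λ x y → :- (x :+ :- y) := y :+ :- x) refl

  -- Lines that meet at `p` and differ at `q` have different slopes, so they swap their order at
  -- `p`; the side on which `q` lies fixes the sign of `δ`.
  module Crossing (K L : Line) {p q : R} (meet : at K p ≡ at L p) (Kq<Lq : at K q < at L q) where
    private
      δ : R
      δ = proj₁ L + - proj₁ K

      δq : 0# < δ * (q + - p)
      δq = subst (0# <_) (sym (gap K L q meet)) (<⇒0<- Kq<Lq)

      K-above : ∀ x → 0# < (- δ) * (x + - p) → at L x < at K x
      K-above x 0< = 0<-⇒< (subst (0# <_)
        (trans (cross δ (x + - p)) (trans (cong -_ (gap K L x meet)) (neg-diff _ _))) 0<)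

      0<-δ : q < p → 0# < - δ
      0<-δ q<p = pos-factorˡ (subst (0# <_)
        (trans (sym (flipped δ (q + - p))) (cong (- δ *_) (neg-diff q p))) δq) (<⇒0<- q<p)

      0<δ : p < q → 0# < δ
      0<δ p<q = pos-factorˡ δq (<⇒0<- p<q)

    other-side-left : p < q → ∀ {x} → x < p → at L x < at K x
    other-side-left p<q {x} x<p = K-above _ (subst (0# <_)
      (trans (cong (δ *_) (sym (neg-diff x p))) (solve 2 (λ u v → u :* :- v := :- u :* v) refl δ (x + - p)))
      (*-pos (0<δ p<q) (<⇒0<- x<p)))

    other-side-right : q < p → ∀ {x} → p < x → at L x < at K x
    other-side-right q<p p<x = K-above _ (*-pos (0<-δ q<p) (<⇒0<- p<x))

-- Bends, transversals and their orders

module Curves (ℝ : RealField) where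
  open OrderedField ℝ

  Disj : (S T : R → R → Set) → Set
  Disj S T = ∀ x y → S x y → ¬ T x y

  data Direction : Set where
    left right : Direction

  Beyond : Direction → R → R → Set
  Beyond left p x = x ≤ p
  Beyond right p x = p ≤ x

  Beyond-apex : ∀ δ {p} → Beyond δ p p
  Beyond-apex left = ≤-refl
  Beyond-apex right = ≤-refl

  Beyond-convex : ∀ δ {p} → Convex (Beyond δ p)
  Beyond-convex left _ z≤p _ y≤z = ≤-trans y≤z z≤p
  Beyond-convex right p≤x _ x≤y _ = ≤-trans p≤x x≤y

  -- Bends: chains whose two half-lines point to the same side.  Such a chain is the union of two graphs
  -- over a common half-line, agreeing at its endpoint.

  record Bend : Set where
    field
      direction : Direction
      apex : R
      branch : Bool → R → R
      continuous : ∀ i → Continuous (branch i)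
      meet : ∀ i j → branch i apex ≡ branch j apex

    Domain : R → Set
    Domain = Beyond direction apex

    -- The branches may cross, as a chain may intersect itself, so neither of them is the upper one
    -- throughout.
    Inner : R → R → Set
    Inner x y = (branch false x < y × y < branch true x) ⊎ (branch true x < y × y < branch false x)

    On : R → R → Set
    On x y = Domain x × ∃ λ i → y ≡ branch i x

  module _ where
    open Bend

    private
      -- Left-pointing domains come first, growing, then the right-pointing ones, shrinking. Hence
      -- the domains that contain a given `x` are consecutive.
      Precedes′ : Direction → R → Direction → R → Set
      Precedes′ left p left q = p ≤ q
      Precedes′ right p right q = p ≤ q
      Precedes′ left _ right _ = ⊤
      Precedes′ right _ left _ = ⊥

      Contains′ : Direction → R → Direction → R → Set
      Contains′ left p left q = q ≤ p
      Contains′ right p right q = p ≤ q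
      Contains′ left _ right _ = ⊥
      Contains′ right _ left _ = ⊥

    -- This total preorder makes Domain c ∩ Domain e ⊆ Domain d whenever c, d, e come in this order.
    Precedes : Bend → Bend → Set
    Precedes c d = Precedes′ (direction c) (apex c) (direction d) (apex d)

    Contains : Bend → Bend → Set
    Contains c d = Contains′ (direction c) (apex c) (direction d) (apex d)

    -- Vacuous for bends with disjoint domains, hence not transitive by itself; `Precedes` repairs
    -- this.
    Below : Bend → Bend → Set
    Below c d = ∀ {x y z} → On c x y → On d x z → y < z

    Inside : Bend → Bend → Set
    Inside c d = ∀ {x y} → On d x y → Inner c x y

    infix 4 _≺↑_ _≺↓_ _≺⊃_

    _≺↑_ _≺↓_ _≺⊃_ : Bend → Bend → Set
    c ≺↑ d = Precedes c d × Below c d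
    c ≺↓ d = Precedes c d × Below d c
    c ≺⊃ d = Contains c d × Inside c d

    Precedes-trans : ∀ c d e → Precedes c d → Precedes d e → Precedes c e
    Precedes-trans c d e with direction c | direction d | direction e
    ... | left | left | left = ≤-trans
    ... | left | left | right = λ _ _ → tt
    ... | left | right | right = λ _ _ → tt
    ... | right | right | right = ≤-trans
    ... | left | right | left = λ _ ()
    ... | right | left | left = λ ()
    ... | right | left | right = λ ()
    ... | right | right | left = λ _ ()

    Precedes-between : ∀ c d e → Precedes c d → Precedes d e →
      ∀ {x} → Domain c x → Domain e x → Domain d x
    Precedes-between c d e with direction c | direction d | direction e
    ... | left | left | _ = λ c≤d _ x≤c _ → ≤-trans x≤c c≤d
    ... | left | right | right = λ _ d≤e _ e≤x → ≤-trans d≤e e≤x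
    ... | right | right | right = λ _ d≤e _ e≤x → ≤-trans d≤e e≤x
    ... | left | right | left = λ _ ()
    ... | right | left | _ = λ ()
    ... | right | right | left = λ _ ()

    Precedes-total : ∀ c d → Precedes c d ⊎ Precedes d c
    Precedes-total c d with direction c | direction d
    ... | left | left = ≤-total _ _
    ... | left | right = inj₁ tt
    ... | right | left = inj₂ tt
    ... | right | right = ≤-total _ _

    Precedes? : Decidable Precedes
    Precedes? c d with direction c | direction d
    ... | left | left = _ ≤? _
    ... | left | right = yes tt
    ... | right | left = no λ ()
    ... | right | right = _ ≤? _

    Contains-trans : ∀ c d e → Contains c d → Contains d e → Contains c e
    Contains-trans c d e with direction c | direction d | direction e
    ... | left | left | left = λ d≤c e≤d → ≤-trans e≤d d≤c
    ... | right | right | right = ≤-trans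
    ... | left | right | _ = λ ()
    ... | right | left | _ = λ ()
    ... | left | left | right = λ _ ()
    ... | right | right | left = λ _ ()

    Contains-⊇ : ∀ c d → Contains c d → ∀ {x} → Domain d x → Domain c x
    Contains-⊇ c d with direction c | direction d
    ... | left | left = λ d≤c x≤d → ≤-trans x≤d d≤c
    ... | right | right = λ c≤d d≤x → ≤-trans c≤d d≤x
    ... | left | right = λ ()
    ... | right | left = λ ()

    Contains? : Decidable Contains
    Contains? c d with direction c | direction d
    ... | left | left = _ ≤? _
    ... | left | right = no λ ()
    ... | right | left = no λ ()
    ... | right | right = _ ≤? _

    Below-through : ∀ {c e} d → (∀ {x} → Domain c x → Domain e x → Domain d x) →
      Below c d → Below d e → Below c e
    Below-through d mid c<d d<e on@(cx , _) on′@(ex , _) =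
      -- Either branch of `d` over the common `x` would serve as the intermediate point.
      let dx = mid cx ex in <-trans (c<d on (dx , true , refl)) (d<e (dx , true , refl) on′)

    ≺↑-trans : Transitive _≺↑_
    ≺↑-trans {c} {d} {e} (cd , c<d) (de , d<e) =
      Precedes-trans c d e cd de , Below-through {c} {e} d (Precedes-between c d e cd de) c<d d<e

    ≺↓-trans : Transitive _≺↓_
    ≺↓-trans {c} {d} {e} (cd , d<c) (de , e<d) =
      Precedes-trans c d e cd de , Below-through {e} {c} d (λ ex cx → Precedes-between c d e cd de cx ex) e<d d<c

    -- Over `x`, the region `Inner c` is an open interval that contains both branches of `d`, hence
    -- everything between them. In the last two cases the branches of `c` would be ordered both
    -- ways.
    Inner-trans : ∀ c d {x y} → Inner c x (branch d false x) → Inner c x (branch d true x) →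
      Inner d x y → Inner c x y
    Inner-trans c d (inj₁ (p , _)) (inj₁ (_ , q)) (inj₁ (r , s)) = inj₁ (<-trans p r , <-trans s q)
    Inner-trans c d (inj₁ (_ , q)) (inj₁ (p , _)) (inj₂ (r , s)) = inj₁ (<-trans p r , <-trans s q)
    Inner-trans c d (inj₂ (p , _)) (inj₂ (_ , q)) (inj₁ (r , s)) = inj₂ (<-trans p r , <-trans s q)
    Inner-trans c d (inj₂ (_ , q)) (inj₂ (p , _)) (inj₂ (r , s)) = inj₂ (<-trans p r , <-trans s q)
    Inner-trans c d (inj₁ (p , q)) (inj₂ (r , s)) _ =
      contradiction (<-trans (<-trans p q) (<-trans r s)) <-irrefl
    Inner-trans c d (inj₂ (p , q)) (inj₁ (r , s)) _ =
      contradiction (<-trans (<-trans p q) (<-trans r s)) <-irrefl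

    ≺⊃-trans : Transitive _≺⊃_
    ≺⊃-trans {c} {d} {e} (cd , c⊃d) (de , d⊃e) = Contains-trans c d e cd de , λ on@(ex , _) →
      let dx = Contains-⊇ d e de ex
      in Inner-trans c d (c⊃d (dx , false , refl)) (c⊃d (dx , true , refl)) (d⊃e on)

    branch-∉-Inner : ∀ c i {x} → ¬ Inner c x (branch c i x)
    branch-∉-Inner c false (inj₁ (p , _)) = <-irrefl p
    branch-∉-Inner c false (inj₂ (_ , p)) = <-irrefl p
    branch-∉-Inner c true (inj₁ (_ , p)) = <-irrefl p
    branch-∉-Inner c true (inj₂ (p , _)) = <-irrefl p

    Below⇒Disj : ∀ {c d} → Below c d → Disj (On c) (On d)
    Below⇒Disj c<d _ _ on on′ = <-irrefl (c<d on on′)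

    Inside⇒Disj : ∀ {c d} → Inside c d → Disj (On c) (On d)
    Inside⇒Disj {c} c⊃d _ _ (_ , i , refl) on′ = branch-∉-Inner c i (c⊃d on′)

    Inner? : ∀ c x y → Dec (Inner c x y)
    Inner? c x y = (¬? (_ ≤? _) ×-dec ¬? (_ ≤? _)) ⊎-dec (¬? (_ ≤? _) ×-dec ¬? (_ ≤? _))

    Below? : Decidable Below
    Below? c d = stable⇒dec λ ¬¬c<d on on′ z≤y → ¬¬c<d λ c<d → c<d on on′ z≤y

    Inside? : Decidable Inside
    Inside? c d = stable⇒dec λ ¬¬c⊃d {x} {y} on →
      decidable-stable (Inner? c x y) λ ¬inner → ¬¬c⊃d λ c⊃d → ¬inner (c⊃d on)

    _≺↑?_ : Decidable _≺↑_
    c ≺↑? d = Precedes? c d ×-dec Below? c d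

    _≺↓?_ : Decidable _≺↓_
    c ≺↓? d = Precedes? c d ×-dec Below? d c

    _≺⊃?_ : Decidable _≺⊃_
    c ≺⊃? d = Contains? c d ×-dec Inside? c d

    module _ (c d : Bend) (disj : Disj (On c) (On d)) where
      private
        Common : R → Set
        Common x = Domain c x × Domain d x

        common-convex : Convex Common
        common-convex (cx , dx) (cz , dz) x≤y y≤z =
          Beyond-convex (direction c) cx cz x≤y y≤z , Beyond-convex (direction d) dx dz x≤y y≤z

        distinct : ∀ i j {x} → Common x → branch c i x ≢ branch d j x
        distinct i j (cx , dx) eq = disj _ _ (cx , i , refl) (dx , j , eq)

        stays-below : ∀ i j {x z} → Common z → Common x →
          branch c i z < branch d j z → branch c i x < branch d j x
        stays-below i j = propagate-< common-convex (continuous c i) (continuous d j) (distinct i j)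

        stays-above : ∀ i j {x z} → Common z → Common x →
          branch d j z < branch c i z → branch d j x < branch c i x
        stays-above i j = propagate-< common-convex (continuous d j) (continuous c i)
          (λ cx eq → distinct i j cx (sym eq))

      -- Over `z` the bend `d` is a single point, with three possible positions relative to the
      -- branches of `c`; disjointness preserves each comparison over the common domain. The third
      -- alternative keeps the premise `Domain c x` because `d` may extend beyond the domain of `c`.
      relative-position : ∀ {z} → Domain c z → Domain d z → (∀ i j → branch d i z ≡ branch d j z) →
        Below c d ⊎ Below d c ⊎ (∀ {x y} → Domain c x → On d x y → Inner c x y)
      relative-position {z} cz dz pinched
        with <-cmp (branch c false z) (branch d true z) | <-cmp (branch c true z) (branch d true z)
      ... | inj₂ (inj₁ eq) | _ = contradiction eq (distinct false true (cz , dz))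
      ... | _ | inj₂ (inj₁ eq) = contradiction eq (distinct true true (cz , dz))
      ... | inj₁ p | inj₁ q = inj₁ λ where
        (cx , false , refl) (dx , j , refl) →
          stays-below false j (cz , dz) (cx , dx) (subst (_ <_) (pinched true j) p)
        (cx , true , refl) (dx , j , refl) →
          stays-below true j (cz , dz) (cx , dx) (subst (_ <_) (pinched true j) q)
      ... | inj₂ (inj₂ p) | inj₂ (inj₂ q) = inj₂ (inj₁ λ where
        (dx , j , refl) (cx , false , refl) →
          stays-above false j (cz , dz) (cx , dx) (subst (_< _) (pinched true j) p)
        (dx , j , refl) (cx , true , refl) →
          stays-above true j (cz , dz) (cx , dx) (subst (_< _) (pinched true j) q))
      ... | inj₁ p | inj₂ (inj₂ q) = inj₂ (inj₂ λ where
        cx (dx , j , refl) → inj₁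
          ( stays-below false j (cz , dz) (cx , dx) (subst (_ <_) (pinched true j) p)
          , stays-above true j (cz , dz) (cx , dx) (subst (_< _) (pinched true j) q)))
      ... | inj₂ (inj₂ p) | inj₁ q = inj₂ (inj₂ λ where
        cx (dx , j , refl) → inj₂
          ( stays-below true j (cz , dz) (cx , dx) (subst (_ <_) (pinched true j) q)
          , stays-above false j (cz , dz) (cx , dx) (subst (_< _) (pinched true j) p)))

    pinched-∉ : ∀ c {x y} → (∀ i j → branch c i x ≡ branch c j x) → ¬ Inner c x y
    pinched-∉ c {x} pinched (inj₁ (p , q)) = <-irrefl (<-trans p (subst (_ <_) (pinched true false) q))
    pinched-∉ c {x} pinched (inj₂ (p , q)) = <-irrefl (<-trans p (subst (_ <_) (pinched false true) q))

    Comparable : Bend → Bend → Set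
    Comparable c d = (c ≺↑ d ⊎ d ≺↑ c) ⊎ (c ≺↓ d ⊎ d ≺↓ c) ⊎ (c ≺⊃ d ⊎ d ≺⊃ c)

    Comparable-sym : ∀ c d → Comparable c d → Comparable d c
    Comparable-sym _ _ (inj₁ r) = inj₁ ([ inj₂ , inj₁ ]′ r)
    Comparable-sym _ _ (inj₂ (inj₁ r)) = inj₂ (inj₁ ([ inj₂ , inj₁ ]′ r))
    Comparable-sym _ _ (inj₂ (inj₂ r)) = inj₂ (inj₂ ([ inj₂ , inj₁ ]′ r))

    -- For equal directions the bend with the smaller domain is examined at its apex, which lies in
    -- the other domain; hence the roles swap for `left`. For opposite directions the domains share
    -- the stretch from `apex d` to `apex c`, or nothing.
    comparable-ordered : ∀ c d → Disj (On c) (On d) → Precedes c d → Comparable c d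
    comparable-ordered c@record { direction = right } d@record { direction = right } disj c≤d
      with relative-position c d disj c≤d ≤-refl (meet d)
    ... | inj₁ c<d = inj₁ (inj₁ (c≤d , c<d))
    ... | inj₂ (inj₁ d<c) = inj₂ (inj₁ (inj₁ (c≤d , d<c)))
    ... | inj₂ (inj₂ inner) = inj₂ (inj₂ (inj₁ (c≤d , λ on@(d≤x , _) → inner (≤-trans c≤d d≤x) on)))
    comparable-ordered c@record { direction = left } d@record { direction = left } disj c≤d
      with relative-position d c (λ x y q p → disj x y p q) c≤d ≤-refl (meet c)
    ... | inj₁ d<c = inj₂ (inj₁ (inj₁ (c≤d , d<c)))
    ... | inj₂ (inj₁ c<d) = inj₁ (inj₁ (c≤d , c<d))
    ... | inj₂ (inj₂ inner) = inj₂ (inj₂ (inj₂ (c≤d , λ on@(x≤c , _) → inner (≤-trans x≤c c≤d) on)))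
    comparable-ordered c@record { direction = left } d@record { direction = right } disj _
      with apex d ≤? apex c
    -- The domains are disjoint, so `Below` holds vacuously.
    ... | no c<d = inj₁ (inj₁ (tt , λ (x≤c , _) (d≤x , _) → contradiction (≤-trans d≤x x≤c) c<d))
    ... | yes d≤c with relative-position c d disj d≤c ≤-refl (meet d)
    ... | inj₁ c<d = inj₁ (inj₁ (tt , c<d))
    ... | inj₂ (inj₁ d<c) = inj₂ (inj₁ (inj₁ (tt , d<c)))
    -- Over its own apex `c` leaves no room between its branches, yet `d` has a point there.
    ... | inj₂ (inj₂ inner) =
      contradiction (inner {apex c} ≤-refl (d≤c , true , refl)) (pinched-∉ c (meet c))

    comparable : ∀ c d → Disj (On c) (On d) → Comparable c d
    comparable c d disj with Precedes-total c d
    ... | inj₁ c≤d = comparable-ordered c d disj c≤d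
    ... | inj₂ d≤c = Comparable-sym d c (comparable-ordered d c (λ x y q p → disj x y p q) d≤c)

  -- Chains in coordinates in which no piece is vertical

  Between : R → R → R → Set
  Between p q x = (p ≤ x × x ≤ q) ⊎ (q ≤ x × x ≤ p)

  Between-sym : ∀ {p q x} → Between p q x → Between q p x
  Between-sym = [ inj₂ , inj₁ ]′

  Between-endˡ : ∀ p q → Between p q p
  Between-endˡ p q = [ (λ p≤q → inj₁ (≤-refl , p≤q)) , (λ q≤p → inj₂ (q≤p , ≤-refl)) ]′ (≤-total p q)

  Between-convex : ∀ {p q} → Convex (Between p q)
  Between-convex (inj₁ (p≤x , _)) (inj₁ (_ , z≤q)) x≤y y≤z = inj₁ (≤-trans p≤x x≤y , ≤-trans y≤z z≤q)
  Between-convex (inj₂ (q≤x , _)) (inj₂ (_ , z≤p)) x≤y y≤z = inj₂ (≤-trans q≤x x≤y , ≤-trans y≤z z≤p)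
  Between-convex (inj₁ (p≤x , x≤q)) (inj₂ (_ , z≤p)) x≤y y≤z =
    inj₁ (≤-trans p≤x x≤y , ≤-trans y≤z (≤-trans z≤p (≤-trans p≤x x≤q)))
  Between-convex (inj₂ (q≤x , x≤p)) (inj₁ (_ , z≤q)) x≤y y≤z =
    inj₂ (≤-trans q≤x x≤y , ≤-trans y≤z (≤-trans z≤q (≤-trans q≤x x≤p)))

  record Chain (δ ε : Direction) : Set where
    field
      a b : R
      ℓ₁ ℓ₀ ℓ₂ : Line
      meetₐ : at ℓ₁ a ≡ at ℓ₀ a
      meetᵦ : at ℓ₀ b ≡ at ℓ₂ b
      a≢b : a ≢ b

    On : R → R → Set
    On x y = (Beyond δ a x × y ≡ at ℓ₁ x) ⊎ (Between a b x × y ≡ at ℓ₀ x) ⊎ (Beyond ε b x × y ≡ at ℓ₂ x)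

  open Chain using (On)

  reverse : ∀ {δ ε} → Chain δ ε → Chain ε δ
  reverse c = record
    { a = b; b = a; ℓ₁ = ℓ₂; ℓ₀ = ℓ₀; ℓ₂ = ℓ₁; meetₐ = sym meetᵦ; meetᵦ = sym meetₐ
    ; a≢b = λ b≡a → a≢b (sym b≡a) }
    where open Chain c

  reverse-On : ∀ {δ ε} (c : Chain δ ε) {x y} → On c x y → On (reverse c) x y
  reverse-On c (inj₁ p) = inj₂ (inj₂ p)
  reverse-On c (inj₂ (inj₁ (btw , eq))) = inj₂ (inj₁ (Between-sym btw , eq))
  reverse-On c (inj₂ (inj₂ p)) = inj₁ p

  -- Transversals: chains with one half-line pointing in each direction

  Transversal : Set
  Transversal = Chain left right

  -- Together the sides cover everything off the chain. Openness is tested only along continuous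
  -- graphs, which avoids a topology on the plane. The fields about `start` tie the sides to the
  -- order of the first half-lines far to the left.
  record Sides (c : Transversal) : Set₁ where
    open Chain c using (ℓ₁)
    field
      Upper Lower : R → R → Set
      exclusive : ∀ {x y} → Upper x y → ¬ Lower x y
      cover : ∀ x y → Upper x y ⊎ Lower x y ⊎ On c x y
      Upper-open : ∀ {f} → Continuous f → Open λ x → Upper x (f x)
      Lower-open : ∀ {f} → Continuous f → Open λ x → Lower x (f x)
      start : R
      Upper-start : ∀ {x y} → x ≤ start → at ℓ₁ x < y → Upper x y
      Lower-start : ∀ {x y} → x ≤ start → y < at ℓ₁ x → Lower x y

  graph-sides : ∀ c g → Continuous g → (∀ x → On c x (g x)) →
    ∀ s → (∀ {x} → x ≤ s → g x ≡ at (Chain.ℓ₁ c) x) → Sides c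
  graph-sides c g cg on s starts = record
    { Upper = λ x y → g x < y
    ; Lower = λ x y → y < g x
    ; exclusive = λ p q → <-irrefl (<-trans p q)
    ; cover = cover
    ; Upper-open = Open-< cg
    ; Lower-open = λ cf → Open-< cf cg
    ; start = s
    ; Upper-start = λ x≤s → subst (_< _) (sym (starts x≤s))
    ; Lower-start = λ x≤s → subst (_ <_) (sym (starts x≤s))
    }
    where
    cover : ∀ x y → g x < y ⊎ y < g x ⊎ On c x y
    cover x y with <-cmp (g x) y
    ... | inj₁ p = inj₁ p
    ... | inj₂ (inj₁ refl) = inj₂ (inj₂ (on x))
    ... | inj₂ (inj₂ p) = inj₂ (inj₁ p)

  -- The sides of a Z-shaped chain: T carries the first half-line, M the segment and B the last half-line.
  -- M ≺ B to the left of b and B ≺ T ≺ M to the right of a ensure that Over and Under miss only points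
  -- of the chain.  The order is abstract so that it can be reversed for the mirrored shape.
  module Zigzag
    (_≺_ : R → R → Set) (≺-trans : Transitive _≺_) (≺-irrefl : ∀ {x} → ¬ (x ≺ x))
    (≺-cmp : ∀ x y → x ≺ y ⊎ x ≡ y ⊎ y ≺ x)
    (Open-≺ : ∀ {f g} → Continuous f → Continuous g → Open λ x → f x ≺ g x)
    (S : R → R → Set) (a b : R) (T M B : R → R)
    (T-continuous : Continuous T) (M-continuous : Continuous M) (B-continuous : Continuous B)
    (T-on : ∀ {x} → x ≤ a → S x (T x))
    (M-on : ∀ {x} → b ≤ x → x ≤ a → S x (M x))
    (B-on : ∀ {x} → b ≤ x → S x (B x))
    (M≺B : ∀ {x} → x < b → M x ≺ B x)
    (B≺T : ∀ {x} → a < x → B x ≺ T x)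
    (T≺M : ∀ {x} → a < x → T x ≺ M x)
    where

    -- The pocket between `B` and `M` is empty to the left of `b`; to the right of `a` it merges
    -- with the region over `T` into everything over `B`.
    Over Under : R → R → Set
    Over x y = T x ≺ y ⊎ (B x ≺ y × y ≺ M x)
    Under x y = y ≺ T x × (y ≺ B x ⊎ M x ≺ y)

    exclusive : ∀ {x y} → Over x y → ¬ Under x y
    exclusive (inj₁ T≺y) (y≺T , _) = ≺-irrefl (≺-trans T≺y y≺T)
    exclusive (inj₂ (B≺y , _)) (_ , inj₁ y≺B) = ≺-irrefl (≺-trans B≺y y≺B)
    exclusive (inj₂ (_ , y≺M)) (_ , inj₂ M≺y) = ≺-irrefl (≺-trans M≺y y≺M)

    cover : ∀ x y → Over x y ⊎ Under x y ⊎ S x y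
    cover x y with ≺-cmp y (T x) | ≺-cmp y (B x) | ≺-cmp y (M x)
    ... | inj₂ (inj₂ T≺y) | _ | _ = inj₁ (inj₁ T≺y)
    ... | inj₁ y≺T | inj₁ y≺B | _ = inj₂ (inj₁ (y≺T , inj₁ y≺B))
    ... | inj₁ y≺T | inj₂ (inj₂ B≺y) | inj₁ y≺M = inj₁ (inj₂ (B≺y , y≺M))
    ... | inj₁ y≺T | inj₂ (inj₂ B≺y) | inj₂ (inj₂ M≺y) = inj₂ (inj₁ (y≺T , inj₂ M≺y))
    ... | inj₁ y≺T | inj₂ (inj₂ B≺y) | inj₂ (inj₁ refl) with <-or-≤ x b | <-or-≤ a x
    ...   | inj₁ x<b | _ = contradiction (≺-trans B≺y (M≺B x<b)) ≺-irrefl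
    ...   | _ | inj₁ a<x = contradiction (≺-trans y≺T (T≺M a<x)) ≺-irrefl
    ...   | inj₂ b≤x | inj₂ x≤a = inj₂ (inj₂ (M-on b≤x x≤a))
    cover x y | inj₁ y≺T | inj₂ (inj₁ refl) | _ with <-or-≤ x b
    ... | inj₁ x<b = inj₂ (inj₁ (y≺T , inj₂ (M≺B x<b)))
    ... | inj₂ b≤x = inj₂ (inj₂ (B-on b≤x))
    -- To the right of `a` the curve `T` is an auxiliary continuation; its points fall into the
    -- pocket.
    cover x y | inj₂ (inj₁ refl) | _ | _ with <-or-≤ a x
    ... | inj₁ a<x = inj₁ (inj₂ (B≺T a<x , T≺M a<x))
    ... | inj₂ x≤a = inj₂ (inj₂ (T-on x≤a))

    Over-open : ∀ {f} → Continuous f → Open λ x → Over x (f x)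
    Over-open cf = Open-∪ (Open-≺ T-continuous cf) (Open-∩ (Open-≺ B-continuous cf) (Open-≺ cf M-continuous))

    Under-open : ∀ {f} → Continuous f → Open λ x → Under x (f x)
    Under-open cf = Open-∩ (Open-≺ cf T-continuous) (Open-∪ (Open-≺ cf B-continuous) (Open-≺ M-continuous cf))

    Under-start : ∀ {x y} → x < b → y ≺ T x → Under x y
    Under-start {x} {y} x<b y≺T with ≺-cmp y (B x)
    ... | inj₁ y≺B = y≺T , inj₁ y≺B
    ... | inj₂ (inj₁ refl) = y≺T , inj₂ (M≺B x<b)
    ... | inj₂ (inj₂ B≺y) = y≺T , inj₂ (≺-trans (M≺B x<b) B≺y)

  module _ (c : Transversal) where
    open Chain c using (a; b; ℓ₁; ℓ₀; ℓ₂; meetₐ; meetᵦ; a≢b)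

    forward-sides : a < b → Sides c
    forward-sides a<b = graph-sides c g
      (glue-continuous a _ _ meet (line-continuous ℓ₁)
        (glue-continuous b _ _ meetᵦ (line-continuous ℓ₀) (line-continuous ℓ₂)))
      on a (glue-≤ a _ _)
      where
      tail g : R → R
      tail = glue b (at ℓ₀) (at ℓ₂)
      g = glue a (at ℓ₁) tail
      meet : at ℓ₁ a ≡ tail a
      meet = trans meetₐ (sym (glue-≤ b _ _ (<⇒≤ a<b)))
      on : ∀ x → On c x (g x)
      on x with ≤-total x a | ≤-total x b
      ... | inj₁ x≤a | _ = inj₁ (x≤a , glue-≤ a _ _ x≤a)
      ... | inj₂ a≤x | inj₁ x≤b =
        inj₂ (inj₁ (inj₁ (a≤x , x≤b) , trans (glue-≥ a _ _ meet a≤x) (glue-≤ b _ _ x≤b)))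
      ... | inj₂ a≤x | inj₂ b≤x =
        inj₂ (inj₂ (b≤x , trans (glue-≥ a _ _ meet a≤x) (glue-≥ b _ _ meetᵦ b≤x)))

    module _ (b<a : b < a) where
      private
        -- The parallel of ℓ₂ through (a , ℓ₁ a); to the right of a it separates ℓ₂ from ℓ₀.
        T-line : Line
        T-line = proj₁ ℓ₂ , proj₂ ℓ₂ + (at ℓ₁ a + - at ℓ₂ a)

        T : R → R
        T = glue a (at ℓ₁) (at T-line)

        lift : ∀ x → at T-line x ≡ at ℓ₂ x + (at ℓ₁ a + - at ℓ₂ a)
        lift x = sym (+-assoc _ _ _)

        T-meet : at ℓ₁ a ≡ at T-line a
        T-meet = sym (trans (lift a) (cancel _ _))

        T-continuous : Continuous T
        T-continuous = glue-continuous a _ _ T-meet (line-continuous ℓ₁) (line-continuous T-line)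

        T-on : ∀ {x} → x ≤ a → On c x (T x)
        T-on x≤a = inj₁ (x≤a , glue-≤ a _ _ x≤a)

        T-right : ∀ {x} → a < x → T x ≡ at T-line x
        T-right a<x = glue-≥ a _ _ T-meet (<⇒≤ a<x)

        M-on : ∀ {x} → b ≤ x → x ≤ a → On c x (at ℓ₀ x)
        M-on b≤x x≤a = inj₂ (inj₁ (inj₂ (b≤x , x≤a) , refl))

        B-on : ∀ {x} → b ≤ x → On c x (at ℓ₂ x)
        B-on b≤x = inj₂ (inj₂ (b≤x , refl))

        start : R
        start = b + - 1#

        start<b : ∀ {x} → x ≤ start → x < b
        start<b x≤s = ≤-<-trans x≤s (x-1<x b)

        T-start : ∀ {x} → x ≤ start → at ℓ₁ x ≡ T x
        T-start x≤s = sym (glue-≤ a _ _ (<⇒≤ (<-trans (start<b x≤s) b<a)))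

      -- Here `ℓ₀` and `ℓ₂` agree at both `a` and `b`: the last half-line retraces the segment, and
      -- the two half-lines contain a graph over the whole axis.
      pinched-sides : at ℓ₁ a ≡ at ℓ₂ a → Sides c
      pinched-sides meet = graph-sides c (glue a (at ℓ₁) (at ℓ₂))
        (glue-continuous a _ _ meet (line-continuous ℓ₁) (line-continuous ℓ₂))
        on a (glue-≤ a _ _)
        where
        on : ∀ x → On c x (glue a (at ℓ₁) (at ℓ₂) x)
        on x with ≤-total x a
        ... | inj₁ x≤a = inj₁ (x≤a , glue-≤ a _ _ x≤a)
        ... | inj₂ a≤x = inj₂ (inj₂ (≤-trans (<⇒≤ b<a) a≤x , glue-≥ a _ _ meet a≤x))

      -- `ℓ₂` is under `ℓ₀` at `a` and meets it at `b`, so it is over `ℓ₀` to the left of `b`. The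
      -- parallel `T-line` is over `ℓ₀` at `b` and meets it at `a`, so it is under `ℓ₀` to the right
      -- of `a`.
      descending-sides : at ℓ₂ a < at ℓ₁ a → Sides c
      descending-sides ℓ₂<ℓ₁ = record
        { Upper = Over ; Lower = Under ; exclusive = exclusive ; cover = cover
        ; Upper-open = Over-open ; Lower-open = Under-open ; start = start
        ; Upper-start = λ x≤s p → inj₁ (subst (_< _) (T-start x≤s) p)
        ; Lower-start = λ x≤s p → Under-start (start<b x≤s) (subst (_ <_) (T-start x≤s) p)
        }
        where
        ℓ₂<T : ∀ x → at ℓ₂ x < at T-line x
        ℓ₂<T x = subst (at ℓ₂ x <_) (sym (lift x)) (x<x+pos (<⇒0<- ℓ₂<ℓ₁))
        open Zigzag _<_ <-trans <-irrefl <-cmp Open-<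
          (On c) a b T (at ℓ₀) (at ℓ₂) T-continuous (line-continuous ℓ₀) (line-continuous ℓ₂) T-on M-on B-on
          (Crossing.other-side-left ℓ₂ ℓ₀ (sym meetᵦ) (subst (at ℓ₂ a <_) meetₐ ℓ₂<ℓ₁) b<a)
          (λ {x} a<x → subst (at ℓ₂ x <_) (sym (T-right a<x)) (ℓ₂<T x))
          (λ {x} a<x → subst (_< at ℓ₀ x) (sym (T-right a<x))
            (Crossing.other-side-right ℓ₀ T-line (trans (sym meetₐ) T-meet)
              (subst (_< at T-line b) (sym meetᵦ) (ℓ₂<T b)) b<a a<x))

      -- The mirror image: with the order reversed, `Over` is the region beneath, so it becomes
      -- `Lower`.
      ascending-sides : at ℓ₁ a < at ℓ₂ a → Sides c
      ascending-sides ℓ₁<ℓ₂ = record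
        { Upper = Under ; Lower = Over ; exclusive = λ p q → exclusive q p
        ; cover = λ x y → [ (λ p → inj₂ (inj₁ p)) , [ inj₁ , (λ p → inj₂ (inj₂ p)) ]′ ]′ (cover x y)
        ; Upper-open = Under-open ; Lower-open = Over-open ; start = start
        ; Upper-start = λ x≤s p → Under-start (start<b x≤s) (subst (_< _) (T-start x≤s) p)
        ; Lower-start = λ x≤s p → inj₁ (subst (_ <_) (T-start x≤s) p)
        }
        where
        >-cmp : ∀ x y → y < x ⊎ x ≡ y ⊎ x < y
        >-cmp x y with <-cmp y x
        ... | inj₁ y<x = inj₁ y<x
        ... | inj₂ (inj₁ y≡x) = inj₂ (inj₁ (sym y≡x))
        ... | inj₂ (inj₂ x<y) = inj₂ (inj₂ x<y)
        T<ℓ₂ : ∀ x → at T-line x < at ℓ₂ x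
        T<ℓ₂ x = subst (_< at ℓ₂ x) (sym (lift x)) (x+neg<x (ℓ₁<ℓ₂))
        open Zigzag (λ x y → y < x) (λ p q → <-trans q p) <-irrefl
          >-cmp
          (λ cf cg → Open-< cg cf)
          (On c) a b T (at ℓ₀) (at ℓ₂) T-continuous (line-continuous ℓ₀) (line-continuous ℓ₂) T-on M-on B-on
          (Crossing.other-side-left ℓ₀ ℓ₂ meetᵦ (subst (_< at ℓ₂ a) meetₐ ℓ₁<ℓ₂) b<a)
          (λ {x} a<x → subst (_< at ℓ₂ x) (sym (T-right a<x)) (T<ℓ₂ x))
          (λ {x} a<x → subst (at ℓ₀ x <_) (sym (T-right a<x))
            (Crossing.other-side-right T-line ℓ₀ (sym (trans (sym meetₐ) T-meet))
              (subst (at T-line b <_) (sym meetᵦ) (T<ℓ₂ b)) b<a a<x))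

      backward-sides : Sides c
      backward-sides with <-cmp (at ℓ₁ a) (at ℓ₂ a)
      ... | inj₁ ℓ₁<ℓ₂ = ascending-sides ℓ₁<ℓ₂
      ... | inj₂ (inj₁ ℓ₁≡ℓ₂) = pinched-sides ℓ₁≡ℓ₂
      ... | inj₂ (inj₂ ℓ₂<ℓ₁) = descending-sides ℓ₂<ℓ₁

    sides : Sides c
    sides with <-cmp a b
    ... | inj₁ a<b = forward-sides a<b
    ... | inj₂ (inj₁ a≡b) = contradiction a≡b a≢b
    ... | inj₂ (inj₂ b<a) = backward-sides b<a

  module Transversals where
    open Chain

    module _ (c : Transversal) {P Q : R → R → Set}
      (P-open : ∀ {f} → Continuous f → Open λ x → P x (f x))
      (Q-open : ∀ {f} → Continuous f → Open λ x → Q x (f x))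
      (exclusive : ∀ {x y} → P x y → ¬ Q x y) (cover : ∀ {x y} → On c x y → P x y ⊎ Q x y) where
      private
        along : ∀ {I} L → Convex I → (∀ {x} → I x → On c x (at L x)) →
          ∀ {x z} → I x → I z → P x (at L x) → P z (at L z)
        along L convex on = propagate convex (P-open (line-continuous L)) (Q-open (line-continuous L))
          (λ _ → exclusive) (λ Ix → cover (on Ix))

      -- A chain is connected: `P` travels along the first half-line to `a`, along the segment to
      -- `b`, and out along the last half-line.
      stays-in : ∀ {z} → z ≤ a c → P z (at (ℓ₁ c) z) → ∀ {x y} → On c x y → P x y
      stays-in {z} z≤a Pz = λ where
          (inj₁ (x≤a , refl)) → first x≤a
          (inj₂ (inj₁ (btw , refl))) → middle btw
          (inj₂ (inj₂ (b≤x , refl))) → last b≤x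
        where
        first : ∀ {x} → x ≤ a c → P x (at (ℓ₁ c) x)
        first x≤a = along (ℓ₁ c) (Beyond-convex left) (λ x≤a → inj₁ (x≤a , refl)) z≤a x≤a Pz
        middle : ∀ {x} → Between (a c) (b c) x → P x (at (ℓ₀ c) x)
        middle btw = along (ℓ₀ c) Between-convex (λ btw → inj₂ (inj₁ (btw , refl)))
          (Between-endˡ (a c) (b c)) btw (subst (P (a c)) (meetₐ c) (first ≤-refl))
        last : ∀ {x} → b c ≤ x → P x (at (ℓ₂ c) x)
        last b≤x = along (ℓ₂ c) (Beyond-convex right) (λ b≤x → inj₂ (inj₂ (b≤x , refl)))
          ≤-refl b≤x (subst (P (b c)) (meetᵦ c) (middle (Between-sym (Between-endˡ (b c) (a c)))))

    infix 4 _⊏_ _≺ₜ_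

    -- Two left-pointing half-lines always have common abscissae, so unlike `Below` this is never
    -- vacuous.
    _⊏_ : Transversal → Transversal → Set
    c ⊏ d = ∀ {x} → x ≤ a c → x ≤ a d → at (ℓ₁ c) x < at (ℓ₁ d) x

    _≺ₜ_ : Transversal → Transversal → Set
    c ≺ₜ d = Disj (On c) (On d) × c ⊏ d

    module _ (c d : Transversal) (disj : Disj (On c) (On d)) where
      private
        I : R → Set
        I x = x ≤ a c × x ≤ a d

        I-convex : Convex I
        I-convex _ (z≤c , z≤d) _ y≤z = ≤-trans y≤z z≤c , ≤-trans y≤z z≤d

        apart : ∀ {x} → I x → at (ℓ₁ c) x ≢ at (ℓ₁ d) x
        apart (x≤c , x≤d) eq = disj _ _ (inj₁ (x≤c , refl)) (inj₁ (x≤d , eq))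

      ⊏-from : ∀ {z} → z ≤ a c → z ≤ a d → at (ℓ₁ c) z < at (ℓ₁ d) z → c ⊏ d
      ⊏-from z≤c z≤d p x≤c x≤d =
        propagate-< I-convex (line-continuous (ℓ₁ c)) (line-continuous (ℓ₁ d)) apart (z≤c , z≤d) (x≤c , x≤d) p

      ⊐-from : ∀ {z} → z ≤ a c → z ≤ a d → at (ℓ₁ d) z < at (ℓ₁ c) z → d ⊏ c
      ⊐-from z≤c z≤d p x≤d x≤c =
        propagate-< I-convex (line-continuous (ℓ₁ d)) (line-continuous (ℓ₁ c)) (λ Ix e → apart Ix (sym e))
          (z≤c , z≤d) (x≤c , x≤d) p

      ⊏-total : c ⊏ d ⊎ d ⊏ c
      ⊏-total with ∃-min (a c) (a d)
      ... | z , z≤c , z≤d , _ with <-cmp (at (ℓ₁ c) z) (at (ℓ₁ d) z)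
      ... | inj₁ p = inj₁ (⊏-from z≤c z≤d p)
      ... | inj₂ (inj₁ e) = contradiction e (apart (z≤c , z≤d))
      ... | inj₂ (inj₂ p) = inj₂ (⊐-from z≤c z≤d p)

    module _ (d : Transversal) where
      open Sides (sides d)

      -- To the left of `start` and of both first vertices `c` is in `Lower`; being disjoint from
      -- `d`, it cannot leave.
      below⇒Lower : ∀ c → c ≺ₜ d → ∀ {x y} → On c x y → Lower x y
      below⇒Lower c (disj , c⊏d) =
        let m , m≤c , m≤d , _ = ∃-min (a c) (a d)
            z , z≤m , z≤s , _ = ∃-min m start
            z≤c = ≤-trans z≤m m≤c
        in stays-in c Lower-open Upper-open (λ p q → exclusive q p)
             (λ on → [ inj₂ , [ inj₁ , (λ on′ → ⊥-elim (disj _ _ on on′)) ]′ ]′ (cover _ _))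
             z≤c (Lower-start z≤s (c⊏d z≤c (≤-trans z≤m m≤d)))

      above⇒Upper : ∀ e → d ≺ₜ e → ∀ {x y} → On e x y → Upper x y
      above⇒Upper e (disj , d⊏e) =
        let m , m≤d , m≤e , _ = ∃-min (a d) (a e)
            z , z≤m , z≤s , _ = ∃-min m start
            z≤e = ≤-trans z≤m m≤e
        in stays-in e Upper-open Lower-open exclusive
             (λ on → [ inj₁ , [ inj₂ , (λ on′ → ⊥-elim (disj _ _ on′ on)) ]′ ]′ (cover _ _))
             z≤e (Upper-start z≤s (d⊏e (≤-trans z≤m m≤d) z≤e))

    -- The middle chain separates the outer two, which makes them disjoint; their order is read off
    -- at a `z` far to the left.
    ≺ₜ-trans : Transitive _≺ₜ_
    ≺ₜ-trans {c} {d} {e} c≺d@(_ , c⊏d) d≺e@(_ , d⊏e) =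
      disj , ⊏-from c e disj z≤c z≤e (<-trans (c⊏d z≤c z≤d) (d⊏e z≤d z≤e))
      where
      disj : Disj (On c) (On e)
      disj _ _ on on′ = Sides.exclusive (sides d) (above⇒Upper d e d≺e on′) (below⇒Lower d c c≺d on)
      m,≤ = ∃-min (a c) (a d)
      z,≤ = ∃-min (proj₁ m,≤) (a e)
      z≤m = proj₁ (proj₂ z,≤)
      z≤c = ≤-trans z≤m (proj₁ (proj₂ m,≤))
      z≤d = ≤-trans z≤m (proj₁ (proj₂ (proj₂ m,≤)))
      z≤e = proj₁ (proj₂ (proj₂ z,≤))

    _≺ₜ?_ : Decidable _≺ₜ_
    c ≺ₜ? d = stable⇒dec (λ ¬¬disj x y on on′ → ¬¬disj λ disj → disj x y on on′)
      ×-dec stable⇒dec (λ ¬¬⊏ x≤c x≤d le → ¬¬⊏ λ ⊏ → ⊏ x≤c x≤d le)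

  open Transversals

  -- Every chain is a transversal or a bend

  data Curve : Set where
    transversal : Transversal → Curve
    bend : Bend → Curve

  OnCurve : Curve → R → R → Set
  OnCurve (transversal c) = On c
  OnCurve (bend b) = Bend.On b

  Represents : Curve → (R → R → Set) → Set
  Represents κ S = ∀ {x y} → (S x y → OnCurve κ x y) × (OnCurve κ x y → S x y)

  branches : (f g : R → R) → Bool → R → R
  branches f g false = f
  branches f g true = g

  -- The apex is the leftmost vertex `a`; one branch is the first half-line, the other the segment
  -- continued by the last half-line. When `b` is leftmost, the chain is reversed first.
  right-bend : (c : Chain right right) → Chain.a c < Chain.b c → ∃ λ κ → Represents κ (On c)
  right-bend c a<b = bend β , λ {x} {y} → to , from
    where
    open Chain c using (a; b; ℓ₁; ℓ₀; ℓ₂; meetₐ; meetᵦ)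
    g : R → R
    g = glue b (at ℓ₀) (at ℓ₂)
    g-meet : at ℓ₁ a ≡ g a
    g-meet = trans meetₐ (sym (glue-≤ b _ _ (<⇒≤ a<b)))
    β : Bend
    β = record
      { direction = right ; apex = a ; branch = branches (at ℓ₁) g
      ; continuous = λ where
          false → line-continuous ℓ₁
          true → glue-continuous b _ _ meetᵦ (line-continuous ℓ₀) (line-continuous ℓ₂)
      ; meet = λ where
          false false → refl
          false true → g-meet
          true false → sym g-meet
          true true → refl
      }
    to : ∀ {x y} → On c x y → Bend.On β x y
    to (inj₁ (a≤x , eq)) = a≤x , false , eq
    to (inj₂ (inj₁ (inj₁ (a≤x , x≤b) , eq))) = a≤x , true , trans eq (sym (glue-≤ b _ _ x≤b))
    to (inj₂ (inj₁ (inj₂ (b≤x , x≤a) , eq))) = contradiction (≤-trans b≤x x≤a) a<b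
    to (inj₂ (inj₂ (b≤x , eq))) =
      ≤-trans (<⇒≤ a<b) b≤x , true , trans eq (sym (glue-≥ b _ _ meetᵦ b≤x))
    from : ∀ {x y} → Bend.On β x y → On c x y
    from (a≤x , false , eq) = inj₁ (a≤x , eq)
    from {x} (a≤x , true , eq) with ≤-total x b
    ... | inj₁ x≤b = inj₂ (inj₁ (inj₁ (a≤x , x≤b) , trans eq (glue-≤ b _ _ x≤b)))
    ... | inj₂ b≤x = inj₂ (inj₂ (b≤x , trans eq (glue-≥ b _ _ meetᵦ b≤x)))

  left-bend : (c : Chain left left) → Chain.b c < Chain.a c → ∃ λ κ → Represents κ (On c)
  left-bend c b<a = bend β , λ {x} {y} → to , from
    where
    open Chain c using (a; b; ℓ₁; ℓ₀; ℓ₂; meetₐ; meetᵦ)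
    g : R → R
    g = glue b (at ℓ₂) (at ℓ₀)
    g-meet : at ℓ₁ a ≡ g a
    g-meet = trans meetₐ (sym (glue-≥ b _ _ (sym meetᵦ) (<⇒≤ b<a)))
    β : Bend
    β = record
      { direction = left ; apex = a ; branch = branches (at ℓ₁) g
      ; continuous = λ where
          false → line-continuous ℓ₁
          true → glue-continuous b _ _ (sym meetᵦ) (line-continuous ℓ₂) (line-continuous ℓ₀)
      ; meet = λ where
          false false → refl
          false true → g-meet
          true false → sym g-meet
          true true → refl
      }
    to : ∀ {x y} → On c x y → Bend.On β x y
    to (inj₁ (x≤a , eq)) = x≤a , false , eq
    to (inj₂ (inj₁ (inj₁ (a≤x , x≤b) , eq))) = contradiction (≤-trans a≤x x≤b) b<a
    to (inj₂ (inj₁ (inj₂ (b≤x , x≤a) , eq))) = x≤a , true , trans eq (sym (glue-≥ b _ _ (sym meetᵦ) b≤x))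
    to (inj₂ (inj₂ (x≤b , eq))) = ≤-trans x≤b (<⇒≤ b<a) , true , trans eq (sym (glue-≤ b _ _ x≤b))
    from : ∀ {x y} → Bend.On β x y → On c x y
    from (x≤a , false , eq) = inj₁ (x≤a , eq)
    from {x} (x≤a , true , eq) with ≤-total x b
    ... | inj₁ x≤b = inj₂ (inj₂ (x≤b , trans eq (glue-≤ b _ _ x≤b)))
    ... | inj₂ b≤x = inj₂ (inj₁ (inj₂ (b≤x , x≤a) , trans eq (glue-≥ b _ _ (sym meetᵦ) b≤x)))

  unreverse : ∀ {δ ε} (c : Chain δ ε) → (∃ λ κ → Represents κ (On (reverse c))) → ∃ λ κ → Represents κ (On c)
  unreverse c (κ , rep) =
    κ , (λ on → proj₁ rep (reverse-On c on)) , (λ on → reverse-On (reverse c) (proj₂ rep on))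

  represent : ∀ {δ ε} (c : Chain δ ε) → ∃ λ κ → Represents κ (On c)
  represent {left} {right} c = transversal c , (λ on → on) , (λ on → on)
  represent {right} {left} c = unreverse c (represent (reverse c))
  represent {right} {right} c with <-cmp (Chain.a c) (Chain.b c)
  ... | inj₁ a<b = right-bend c a<b
  ... | inj₂ (inj₁ a≡b) = contradiction a≡b (Chain.a≢b c)
  ... | inj₂ (inj₂ b<a) = unreverse c (right-bend (reverse c) b<a)
  represent {left} {left} c with <-cmp (Chain.a c) (Chain.b c)
  ... | inj₁ a<b = unreverse c (left-bend (reverse c) a<b)
  ... | inj₂ (inj₁ a≡b) = contradiction a≡b (Chain.a≢b c)
  ... | inj₂ (inj₂ b<a) = left-bend c b<a

-- Colouring by height in a strict partial order (Mirsky's argument)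

module Heights {n : ℕ} (E : Fin n → Fin n → Set) (E-sym : Symmetric E) (E-irrefl : ∀ {i} → ¬ E i i)
  (ω : ℕ) (no-clique : ¬ HasClique E (suc ω))
  (_≺_ : Fin n → Fin n → Set) (_≺?_ : Decidable _≺_) (≺-trans : Transitive _≺_)
  (≺⇒E : ∀ {i j} → i ≺ j → E i j) where

  -- Rises m i: some ≺-chain of m + 1 elements ends at i.
  Rises : ℕ → Fin n → Set
  Rises zero i = ⊤
  Rises (suc m) i = ∃ λ j → j ≺ i × Rises m j

  Rises? : ∀ m i → Dec (Rises m i)
  Rises? zero i = yes tt
  Rises? (suc m) i = any? λ j → (j ≺? i) ×-dec Rises? m j

  descend : ∀ m {i} → Rises m i → Fin (suc m) → Fin n
  descend _ {i} _ zero = i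
  descend (suc m) (_ , _ , r) (suc k) = descend m r k

  descend-≺ : ∀ m {i j} (r : Rises m i) → i ≺ j → ∀ k → descend m r k ≺ j
  descend-≺ m r i≺j zero = i≺j
  descend-≺ (suc m) (_ , k≺i , r) i≺j (suc k) = descend-≺ m r (≺-trans k≺i i≺j) k

  descend-E : ∀ m {i} (r : Rises m i) p q → p ≢ q → E (descend m r p) (descend m r q)
  descend-E m r zero zero p≢q = contradiction refl p≢q
  descend-E (suc m) (_ , j≺i , r) zero (suc q) _ = E-sym (≺⇒E (descend-≺ m r j≺i q))
  descend-E (suc m) (_ , j≺i , r) (suc p) zero _ = ≺⇒E (descend-≺ m r j≺i p)
  descend-E (suc m) (_ , _ , r) (suc p) (suc q) p≢q = descend-E m r p q λ p≡q → p≢q (cong suc p≡q)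

  ¬Rises-ω : ∀ i → ¬ Rises ω i
  ¬Rises-ω i r = no-clique (descend ω r , injective , descend-E ω r)
    where
    injective : ∀ p q → descend ω r p ≡ descend ω r q → p ≡ q
    injective p q eq with p ≟ᶠ q
    ... | yes p≡q = p≡q
    ... | no p≢q = contradiction (subst (E _) (sym eq) (descend-E ω r p q p≢q)) E-irrefl

  -- A search downwards from `m`. It cannot run out, because `Rises zero` always holds.
  highest : ∀ {i} m → ¬ Rises m i → ∃ λ h → h ℕ.< m × Rises h i × ¬ Rises (suc h) i
  highest zero ¬r = contradiction tt ¬r
  highest {i} (suc m) ¬r with Rises? m i
  ... | yes r = m , ℕₚ.≤-refl , r , ¬r
  ... | no ¬r′ = let h , h<m , rest = highest m ¬r′ in h , ℕₚ.m≤n⇒m≤1+n h<m , rest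

  height : Fin n → Fin ω
  height i = let _ , h<ω , _ = highest ω (¬Rises-ω i) in fromℕ< h<ω

  height-≢ : ∀ {i j} → i ≺ j → height i ≢ height j
  height-≢ {i} {j} i≺j eq with highest ω (¬Rises-ω i) | highest ω (¬Rises-ω j)
  -- With equal heights, the longest chain ending at `i` could be prolonged by `j`, against the
  -- maximality for `j`.
  ... | h , h<ω , r , _ | h′ , h′<ω , _ , top with refl ← fromℕ<-injective _ _ h<ω h′<ω eq = top (i , i≺j , r)

  height-≢′ : ∀ {i j} → i ≺ j ⊎ j ≺ i → height i ≢ height j
  height-≢′ (inj₁ i≺j) = height-≢ i≺j
  height-≢′ (inj₂ j≺i) eq = height-≢ j≺i (sym eq)

-- Combining the four heights into one colouring

module CurveColouring (ℝ : RealField) {n : ℕ} (κ : Fin n → Curves.Curve ℝ) (ω : ℕ) where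
  open Curves ℝ
  open Transversals

  private
    E : Fin n → Fin n → Set
    E i j = Disj (OnCurve (κ i)) (OnCurve (κ j))

    E-sym : Symmetric E
    E-sym disj x y on on′ = disj x y on′ on

    inhabited : ∀ c → ∃ λ x → ∃ λ y → OnCurve c x y
    inhabited (transversal c) = _ , _ , inj₁ (OrderedField.≤-refl ℝ , refl)
    inhabited (bend b) = _ , _ , Beyond-apex (Bend.direction b) , false , refl

    E-irrefl : ∀ {i} → ¬ E i i
    E-irrefl {i} disj = let _ , _ , on = inhabited (κ i) in disj _ _ on on

    -- Extended by `⊥` to all curves, as `Bends` is, so that every height is defined on the whole
    -- vertex set.
    Across : Curve → Curve → Set
    Across (transversal c) (transversal d) = c ≺ₜ d
    Across _ _ = ⊥

    Across-trans : Transitive Across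
    Across-trans {transversal c} {transversal d} {transversal e} = ≺ₜ-trans {c} {d} {e}

    Across? : Decidable Across
    Across? (transversal c) (transversal d) = c ≺ₜ? d
    Across? (transversal _) (bend _) = no λ ()
    Across? (bend _) (transversal _) = no λ ()
    Across? (bend _) (bend _) = no λ ()

    Across⇒Disj : ∀ c d → Across c d → Disj (OnCurve c) (OnCurve d)
    Across⇒Disj (transversal c) (transversal d) (disj , _) = disj

    Bends : (Bend → Bend → Set) → Curve → Curve → Set
    Bends _≺_ (bend c) (bend d) = c ≺ d
    Bends _ _ _ = ⊥

    Bends-trans : ∀ {_≺_} → Transitive _≺_ → Transitive (Bends _≺_)
    Bends-trans ≺-trans {bend c} {bend d} {bend e} = ≺-trans

    Bends? : ∀ {_≺_} → Decidable _≺_ → Decidable (Bends _≺_)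
    Bends? _≺?_ (bend c) (bend d) = c ≺? d
    Bends? _ (transversal _) (transversal _) = no λ ()
    Bends? _ (transversal _) (bend _) = no λ ()
    Bends? _ (bend _) (transversal _) = no λ ()

    Bends⇒Disj : ∀ {_≺_} → (∀ {c d} → c ≺ d → Disj (Bend.On c) (Bend.On d)) →
      ∀ c d → Bends _≺_ c d → Disj (OnCurve c) (OnCurve d)
    Bends⇒Disj ≺⇒Disj (bend c) (bend d) = ≺⇒Disj

  module _ (no-clique : ¬ HasClique E (suc ω)) where
    private
      module H (_≺_ : Curve → Curve → Set) (_≺?_ : Decidable _≺_) (≺-trans : Transitive _≺_)
        (≺⇒Disj : ∀ c d → c ≺ d → Disj (OnCurve c) (OnCurve d)) =
        Heights E (λ {i} {j} → E-sym {i} {j}) (λ {i} → E-irrefl {i}) ω no-clique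
          (λ i j → κ i ≺ κ j) (λ i j → κ i ≺? κ j)
          (λ {i} {j} {k} → ≺-trans {κ i} {κ j} {κ k}) (λ {i} {j} → ≺⇒Disj (κ i) (κ j))

      module H₀ = H Across Across? (λ {i} {j} {k} → Across-trans {i} {j} {k}) Across⇒Disj
      module H↑ = H (Bends _≺↑_) (Bends? _≺↑?_)
        (λ {i} {j} {k} → Bends-trans (λ {c} {d} {e} → ≺↑-trans {c} {d} {e}) {i} {j} {k})
        (Bends⇒Disj λ {c} {d} p → Below⇒Disj {c} {d} (proj₂ p))
      module H↓ = H (Bends _≺↓_) (Bends? _≺↓?_)
        (λ {i} {j} {k} → Bends-trans (λ {c} {d} {e} → ≺↓-trans {c} {d} {e}) {i} {j} {k})
        (Bends⇒Disj λ {c} {d} p x y on on′ → Below⇒Disj {d} {c} (proj₂ p) x y on′ on)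
      module H⊃ = H (Bends _≺⊃_) (Bends? _≺⊃?_)
        (λ {i} {j} {k} → Bends-trans (λ {c} {d} {e} → ≺⊃-trans {c} {d} {e}) {i} {j} {k})
        (Bends⇒Disj λ {c} {d} p → Inside⇒Disj {c} {d} (proj₂ p))

      heights : Fin n → Fin (ω ℕ.^ 3)
      -- `ω ^ 3` unfolds to `ω * (ω * (ω * 1))`; the final `zero` fills the factor `Fin 1`.
      heights i = combine (H↑.height i) (combine (H↓.height i) (combine (H⊃.height i) zero))

      colour : Curve → Fin n → Fin (ω ℕ.^ 3) ⊎ Fin ω
      colour (bend _) i = inj₁ (heights i)
      colour (transversal _) i = inj₂ (H₀.height i)

      -- `colour-≢` matches on `c` and `d` in place of `κ i` and `κ j`; the equations carry its
      -- conclusions back to the vertices.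
      related : (ρ : Curve → Curve → Set) → ∀ {i j c d} → κ i ≡ c → κ j ≡ d →
        ρ c d ⊎ ρ d c → ρ (κ i) (κ j) ⊎ ρ (κ j) (κ i)
      related ρ refl refl r = r

      colour-≢ : ∀ {i j} c d → κ i ≡ c → κ j ≡ d → Disj (OnCurve c) (OnCurve d) → colour c i ≢ colour d j
      colour-≢ (bend _) (transversal _) _ _ _ ()
      colour-≢ (transversal _) (bend _) _ _ _ ()
      colour-≢ {i} {j} (transversal c) (transversal d) eqᵢ eqⱼ disj eq =
        H₀.height-≢′ {i} {j} (related Across eqᵢ eqⱼ
          ([ (λ p → inj₁ (disj , p)) , (λ p → inj₂ ((λ x y on on′ → disj x y on′ on) , p)) ]′ (⊏-total c d disj)))
          (inj₂-injective eq)
      colour-≢ {i} {j} (bend c) (bend d) eqᵢ eqⱼ disj eq =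
        let eq↑ , eq′ = combine-injective (H↑.height i) _ (H↑.height j) _ (inj₁-injective eq)
            eq↓ , eq″ = combine-injective (H↓.height i) _ (H↓.height j) _ eq′
            eq⊃ , _ = combine-injective (H⊃.height i) (zero {0}) (H⊃.height j) zero eq″
        in [ (λ r → H↑.height-≢′ {i} {j} (related (Bends _≺↑_) eqᵢ eqⱼ r) eq↑)
           , [ (λ r → H↓.height-≢′ {i} {j} (related (Bends _≺↓_) eqᵢ eqⱼ r) eq↓)
             , (λ r → H⊃.height-≢′ {i} {j} (related (Bends _≺⊃_) eqᵢ eqⱼ r) eq⊃) ]′ ]′
           (comparable c d disj)

    curve-colouring : Colourable E (ω ℕ.^ 3 ℕ.+ ω)
    curve-colouring = (λ i → join (ω ℕ.^ 3) ω (colour (κ i) i)) , λ i j disj eq →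
      colour-≢ (κ i) (κ j) refl refl disj (trans (sym (splitAt-join (ω ℕ.^ 3) ω (colour (κ i) i)))
        (trans (cong (splitAt (ω ℕ.^ 3)) eq) (splitAt-join (ω ℕ.^ 3) ω (colour (κ j) j))))

-- Shearing the plane so that no piece is vertical

module Shear (ℝ : RealField) where
  open OrderedField ℝ
  open Curves ℝ
  open Plane ℝ

  data Pointing : Direction → R → Set where
    leftwards : ∀ {z} → z < 0# → Pointing left z
    rightwards : ∀ {z} → 0# < z → Pointing right z

  pointing : ∀ {z} → z ≢ 0# → ∃ λ δ → Pointing δ z
  pointing {z} z≢0 with <-cmp z 0#
  ... | inj₁ z<0 = left , leftwards z<0
  ... | inj₂ (inj₁ z≡0) = contradiction z≡0 z≢0
  ... | inj₂ (inj₂ 0<z) = right , rightwards 0<z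

  neg-pos : ∀ {z} → z < 0# → 0# < - z
  neg-pos z<0 -z≤0 = z<0 (0≤-⇒≤ (subst (0# ≤_)
    (solve 1 (λ z → :- (:- z) := z :+ :- con (0 , 0)) refl _) (neg-nonneg -z≤0)))

  opposite : Direction → Direction
  opposite left = right
  opposite right = left

  Pointing-opposite : ∀ {δ z} → Pointing δ z → Pointing (opposite δ) (- z)
  Pointing-opposite (leftwards z<0) = rightwards (neg-pos z<0)
  Pointing-opposite (rightwards 0<z) = leftwards λ 0≤-z → 0<z (neg-nonpos 0≤-z)

  forwards : ∀ {δ z} → Pointing δ z → ∀ p {t} → 0# ≤ t → Beyond δ p (p + t * z)
  forwards {z = z} (rightwards 0<z) p {t} 0≤t = 0≤-⇒≤ (subst (0# ≤_)
    (solve 3 (λ p t z → t :* z := (p :+ t :* z) :+ :- p) refl p t z) (*-nonneg t z 0≤t (<⇒≤ 0<z)))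
  forwards {z = z} (leftwards z<0) p {t} 0≤t = 0≤-⇒≤ (subst (0# ≤_)
    (solve 3 (λ p t z → t :* :- z := p :+ :- (p :+ t :* z)) refl p t z)
    (*-nonneg t (- z) 0≤t (neg-nonneg (<⇒≤ z<0))))

  -- The inverse `i` has the sign of `z`, which is also the side of `p` on which `x` lies.
  parameter-nonneg : ∀ {δ z} → Pointing δ z → ∀ {i} → z * i ≡ 1# →
    ∀ p x → Beyond δ p x → 0# ≤ (x + - p) * i
  parameter-nonneg (rightwards 0<z) {i} zi≡1 p x p≤x =
    *-nonneg _ i (≤⇒0≤- p≤x) (<⇒≤ (inverse-pos 0<z zi≡1))
  parameter-nonneg {z = z} (leftwards z<0) {i} zi≡1 p x x≤p = subst (0# ≤_)
    (solve 3 (λ p x i → (p :+ :- x) :* :- i := (x :+ :- p) :* i) refl p x i)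
    (*-nonneg _ (- i) (≤⇒0≤- x≤p)
      (<⇒≤ (inverse-pos (neg-pos z<0) (trans (solve 2 (λ z i → :- z :* :- i := z :* i) refl z i) zi≡1))))

  Between⇒Beyond : ∀ {δ p q} → Pointing δ (q + - p) → ∀ {x} → Between p q x →
    Beyond δ p x × Beyond (opposite δ) q x
  Between⇒Beyond (rightwards _) (inj₁ btw) = btw
  Between⇒Beyond (rightwards 0<) (inj₂ (q≤x , x≤p)) = contradiction (≤-trans q≤x x≤p) (0<-⇒< 0<)
  Between⇒Beyond (leftwards _) (inj₂ (q≤x , x≤p)) = x≤p , q≤x
  Between⇒Beyond {p = p} {q} (leftwards <0) (inj₁ (p≤x , x≤q)) = contradiction (≤⇒0≤- (≤-trans p≤x x≤q)) <0

  Beyond⇒Between : ∀ δ {p q x} → Beyond δ p x → Beyond (opposite δ) q x → Between p q x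
  Beyond⇒Between left x≤p q≤x = inj₂ (q≤x , x≤p)
  Beyond⇒Between right p≤x x≤q = inj₁ (p≤x , x≤q)

  module _ (s : R) where

    -- The new abscissa under the shear that keeps ordinates. It is linear, so it applies to
    -- directions too: a direction becomes vertical exactly where it vanishes.
    X : Point → R
    X (p₁ , p₂) = p₁ + s * p₂

    unshear : R → R → Point
    unshear x y = x + - (s * y) , y

    X-⊖ : ∀ p q → X (p ⊖ q) ≡ X p + - X q
    X-⊖ (p₁ , p₂) (q₁ , q₂) = solve 5 (λ s p₁ p₂ q₁ q₂ →
      (p₁ :+ :- q₁) :+ s :* (p₂ :+ :- q₂) := (p₁ :+ s :* p₂) :+ :- (q₁ :+ s :* q₂)) refl s p₁ p₂ q₁ q₂

    X-ray : ∀ p t w → X (p ⊕ (t · w)) ≡ X p + t * X w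
    X-ray (p₁ , p₂) t (w₁ , w₂) = solve 6 (λ s p₁ p₂ t w₁ w₂ →
      (p₁ :+ t :* w₁) :+ s :* (p₂ :+ t :* w₂) := (p₁ :+ s :* p₂) :+ t :* (w₁ :+ s :* w₂)) refl s p₁ p₂ t w₁ w₂

    module Through (p w : Point) {i : R} (Xw*i≡1 : X w * i ≡ 1#) where
      open ≡-Reasoning
      private
        p₂ = proj₂ p
        w₁ = proj₁ w
        w₂ = proj₂ w

      line : Line
      line = w₂ * i , p₂ + - (w₂ * i * X p)

      start-on-line : at line (X p) ≡ p₂
      start-on-line = cancel _ _

      point-on-line : ∀ t → at line (X p + t * X w) ≡ p₂ + t * w₂
      point-on-line t = begin
        w₂ * i * (X p + t * X w) + (p₂ + - (w₂ * i * X p))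
          ≡⟨ solve 6 (λ w₂ i x t z p₂ → w₂ :* i :* (x :+ t :* z) :+ (p₂ :+ :- (w₂ :* i :* x))
               := p₂ :+ t :* w₂ :* (z :* i)) refl w₂ i (X p) t (X w) p₂ ⟩
        p₂ + t * w₂ * (X w * i)     ≡⟨ cong (λ o → p₂ + t * w₂ * o) Xw*i≡1 ⟩
        p₂ + t * w₂ * 1#            ≡⟨ solve 2 (λ p₂ u → p₂ :+ u :* con (1 , 0) := p₂ :+ u) refl p₂ (t * w₂) ⟩
        p₂ + t * w₂                 ∎

      on-line : ∀ t → proj₂ (p ⊕ (t · w)) ≡ at line (X (p ⊕ (t · w)))
      on-line t = sym (trans (cong (at line) (X-ray p t w)) (point-on-line t))

      time : R → R
      time x = (x + - X p) * i

      position : ∀ x → X p + time x * X w ≡ x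
      position x = begin
        X p + (x + - X p) * i * X w
          ≡⟨ solve 4 (λ p x i z → p :+ (x :+ :- p) :* i :* z := p :+ (x :+ :- p) :* (z :* i)) refl (X p) x i (X w) ⟩
        X p + (x + - X p) * (X w * i)     ≡⟨ cong (λ o → X p + (x + - X p) * o) Xw*i≡1 ⟩
        X p + (x + - X p) * 1#
          ≡⟨ solve 2 (λ p x → p :+ (x :+ :- p) :* con (1 , 0) := x) refl (X p) x ⟩
        x                                 ∎

      unshear-line : ∀ x → unshear x (at line x) ≡ p ⊕ (time x · w)
      unshear-line x = begin
        unshear x (at line x)
          ≡⟨ cong (λ z → unshear z (at line z)) (sym (trans (X-ray p (time x) w) (position x))) ⟩
        unshear (X q) (at line (X q))
          ≡⟨ cong (unshear (X q)) (sym (on-line (time x))) ⟩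
        unshear (X q) (proj₂ q)
          ≡⟨ cong (_, proj₂ q) (solve 3 (λ s q₁ q₂ → (q₁ :+ s :* q₂) :+ :- (s :* q₂) := q₁) refl s (proj₁ q) (proj₂ q)) ⟩
        q ∎
        where q = p ⊕ (time x · w)

    module Sheared (c : Chain3) (Xu≢0 : X (Chain3.u c) ≢ 0#) (Xv≢0 : X (Chain3.v c) ≢ 0#)
      (Xba≢0 : X (Chain3.b c ⊖ Chain3.a c) ≢ 0#) where
      open Chain3 c
      private
        w : Point
        w = b ⊖ a
        i = proj₁ (inverse (X w) Xba≢0)
        Xw*i≡1 = proj₂ (inverse (X w) Xba≢0)
        module U = Through a u (proj₂ (inverse (X u) Xu≢0))
        module W = Through a w Xw*i≡1
        module V = Through b v (proj₂ (inverse (X v) Xv≢0))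
        δ = proj₁ (pointing Xu≢0)
        ε = proj₁ (pointing Xv≢0)
        ζ = proj₁ (pointing Xba≢0)

      chain : Chain δ ε
      chain = record
        { a = X a ; b = X b ; ℓ₁ = U.line ; ℓ₀ = W.line ; ℓ₂ = V.line
        ; meetₐ = trans U.start-on-line (sym W.start-on-line)
        ; meetᵦ = trans at-b (sym V.start-on-line)
        ; a≢b = λ Xa≡Xb → Xba≢0 (trans (X-⊖ b a) (trans (cong (λ x → X b + - x) Xa≡Xb)
            (solve 1 (λ x → x :+ :- x := con (0 , 0)) refl (X b))))
        }
        where
        open ≡-Reasoning
        at-b : at W.line (X b) ≡ proj₂ b
        at-b = begin
          at W.line (X b)
            ≡⟨ cong (at W.line) (solve 2 (λ x y → y := x :+ con (1 , 0) :* (y :+ :- x)) refl (X a) (X b)) ⟩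
          at W.line (X a + 1# * (X b + - X a))
            ≡⟨ cong (λ z → at W.line (X a + 1# * z)) (sym (X-⊖ b a)) ⟩
          at W.line (X a + 1# * X w)
            ≡⟨ W.point-on-line 1# ⟩
          proj₂ a + 1# * (proj₂ b + - proj₂ a)
            ≡⟨ solve 2 (λ x y → x :+ con (1 , 0) :* (y :+ :- x) := y) refl (proj₂ a) (proj₂ b) ⟩
          proj₂ b ∎

      private
        Pointing-w : Pointing ζ (X b + - X a)
        Pointing-w = subst (Pointing ζ) (X-⊖ b a) (proj₂ (pointing Xba≢0))

        -- Read backwards from `b`, the segment has parameter `1 - t`, so the bound `t ≤ 1` becomes
        -- another half-line condition. `remaining` is the converse reading.
        from-b : ∀ t → X a + t * X w ≡ X b + (1# + - t) * (- X w)
        from-b t = subst (λ z → X a + t * z ≡ X b + (1# + - t) * (- z)) (sym (X-⊖ b a))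
          (solve 3 (λ a b t → a :+ t :* (b :+ :- a) := b :+ (con (1 , 0) :+ :- t) :* :- (b :+ :- a)) refl (X a) (X b) t)

        remaining : ∀ x → (x + - X b) * (- i) ≡ 1# + - W.time x
        remaining x = begin
          (x + - X b) * (- i)
            ≡⟨ solve 4 (λ a b x i → (x :+ :- b) :* :- i := (b :+ :- a) :* i :+ :- ((x :+ :- a) :* i)) refl (X a) (X b) x i ⟩
          (X b + - X a) * i + - W.time x
            ≡⟨ cong (λ z → z * i + - W.time x) (sym (X-⊖ b a)) ⟩
          X w * i + - W.time x
            ≡⟨ cong (_+ - W.time x) Xw*i≡1 ⟩
          1# + - W.time x ∎
          where open ≡-Reasoning

      shear-on : ∀ p → OnChain c p → Chain.On chain (X p) (proj₂ p)
      shear-on _ (inj₁ (t , 0≤t , refl)) =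
        inj₁ (subst (Beyond δ (X a)) (sym (X-ray a t u)) (forwards (proj₂ (pointing Xu≢0)) (X a) 0≤t) , U.on-line t)
      shear-on _ (inj₂ (inj₂ (t , 0≤t , refl))) =
        inj₂ (inj₂ (subst (Beyond ε (X b)) (sym (X-ray b t v)) (forwards (proj₂ (pointing Xv≢0)) (X b) 0≤t) , V.on-line t))
      shear-on _ (inj₂ (inj₁ (t , 0≤t , t≤1 , refl))) =
        inj₂ (inj₁ (subst (Between (X a) (X b)) (sym (X-ray a t w)) (Beyond⇒Between ζ
          (forwards (proj₂ (pointing Xba≢0)) (X a) 0≤t)
          (subst (Beyond (opposite ζ) (X b)) (sym (from-b t))
            (forwards (Pointing-opposite (proj₂ (pointing Xba≢0))) (X b) (≤⇒0≤- t≤1)))) , W.on-line t))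

      unshear-on : ∀ x y → Chain.On chain x y → OnChain c (unshear x y)
      unshear-on x _ (inj₁ (beyond , refl)) = inj₁ (U.time x
        , parameter-nonneg (proj₂ (pointing Xu≢0)) (proj₂ (inverse (X u) Xu≢0)) (X a) x beyond
        , U.unshear-line x)
      unshear-on x _ (inj₂ (inj₂ (beyond , refl))) = inj₂ (inj₂ (V.time x
        , parameter-nonneg (proj₂ (pointing Xv≢0)) (proj₂ (inverse (X v) Xv≢0)) (X b) x beyond
        , V.unshear-line x))
      unshear-on x _ (inj₂ (inj₁ (between , refl))) =
        let beyondₐ , beyondᵦ = Between⇒Beyond Pointing-w between
        in inj₂ (inj₁ (W.time x
        , parameter-nonneg (proj₂ (pointing Xba≢0)) Xw*i≡1 (X a) x beyondₐ
        , 0≤-⇒≤ (subst (0# ≤_) (remaining x)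
            (parameter-nonneg (Pointing-opposite (proj₂ (pointing Xba≢0)))
              (trans (solve 2 (λ z i → :- z :* :- i := z :* i) refl (X w) i) Xw*i≡1) (X b) x beyondᵦ))
        , W.unshear-line x))

  -- Generic shears

  -- As an equation in `s`, `w₁ + s * w₂ ≡ 0#` has only the root `- w₁ / w₂`, or none if `w₂` is
  -- zero. A bound, in contrast to an excluded value, lets finitely many vectors be combined by a
  -- maximum.
  shears-properly : ∀ w → w ≢ origin → ∃ λ r → ∀ {s} → r < s → X s w ≢ 0#
  shears-properly (w₁ , w₂) w≢0 = [ slanted , horizontal ]′ w₂-cases
    where
    open ≡-Reasoning
    w₂-cases : w₂ ≢ 0# ⊎ w₂ ≡ 0#
    w₂-cases with <-cmp w₂ 0#
    ... | inj₁ w₂<0 = inj₁ λ w₂≡0 → w₂<0 (≤-reflexive (sym w₂≡0))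
    ... | inj₂ (inj₁ w₂≡0) = inj₂ w₂≡0
    ... | inj₂ (inj₂ 0<w₂) = inj₁ λ w₂≡0 → 0<w₂ (≤-reflexive w₂≡0)
    horizontal : w₂ ≡ 0# → ∃ λ r → ∀ {s} → r < s → X s (w₁ , w₂) ≢ 0#
    horizontal refl = 0# , λ {s} _ X≡0 → w≢0 (cong (_, 0#)
      (trans (solve 2 (λ s w₁ → w₁ := w₁ :+ s :* con (0 , 0)) refl s w₁) X≡0))
    slanted : w₂ ≢ 0# → ∃ λ r → ∀ {s} → r < s → X s (w₁ , w₂) ≢ 0#
    slanted w₂≢0 =
      let i , w₂i≡1 = inverse w₂ w₂≢0
      in - w₁ * i , λ {s} r<s X≡0 → r<s (≤-reflexive (begin
        s                             ≡⟨ solve 1 (λ s → s := s :* con (1 , 0)) refl s ⟩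
        s * 1#                        ≡⟨ cong (s *_) (sym w₂i≡1) ⟩
        s * (w₂ * i)                  ≡⟨ solve 4 (λ s w₁ w₂ i →
                                           s :* (w₂ :* i) := (w₁ :+ s :* w₂) :* i :+ :- w₁ :* i) refl s w₁ w₂ i ⟩
        (w₁ + s * w₂) * i + - w₁ * i  ≡⟨ cong (λ z → z * i + - w₁ * i) X≡0 ⟩
        0# * i + - w₁ * i             ≡⟨ solve 2 (λ i z → con (0 , 0) :* i :+ z := z) refl i (- w₁ * i) ⟩
        - w₁ * i                      ∎))

  upper-bound : ∀ {n} (f : Fin n → R) → ∃ λ r → ∀ i → f i ≤ r
  upper-bound {zero} f = 0# , λ ()
  upper-bound {suc n} f =
    let r , ≤r = upper-bound (λ i → f (suc i))
        r′ , f0≤r′ , r≤r′ , _ = ∃-max (f zero) r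
    in r′ , λ where
      zero → f0≤r′
      (suc i) → ≤-trans (≤r i) r≤r′

  generic-shear : ∀ {n} (w : Fin n → Point) → (∀ i → w i ≢ origin) →
    ∃ λ r → ∀ {s} → r < s → ∀ i → X s (w i) ≢ 0#
  generic-shear w w≢0 =
    let r , ≤r = upper-bound (λ i → proj₁ (shears-properly (w i) (w≢0 i)))
    in r , λ r<s i → proj₂ (shears-properly (w i) (w≢0 i)) (≤-<-trans (≤r i) r<s)

  ⊖-≢-origin : ∀ p q → p ≢ q → q ⊖ p ≢ origin
  ⊖-≢-origin (p₁ , p₂) (q₁ , q₂) p≢q eq = p≢q (cong₂ _,_ (same (cong proj₁ eq)) (same (cong proj₂ eq)))
    where
    same : ∀ {x y} → y + - x ≡ 0# → x ≡ y
    same {x} {y} e = trans (solve 1 (λ x → x := x :+ con (0 , 0)) refl x) (trans (cong (x +_) (sym e)) (cancel x y))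

  module _ {n : ℕ} (C : Fin n → Chain3) where
    open Chain3

    curves : ∃ λ (κ : Fin n → Curve) → ∀ i j →
      (Disjoint (C i) (C j) → Disj (OnCurve (κ i)) (OnCurve (κ j))) ×
      (Disj (OnCurve (κ i)) (OnCurve (κ j)) → Disjoint (C i) (C j))
    curves = κ , λ i j →
        (λ disjoint x y on on′ → disjoint (unshear s x y
          , unshear-on i x y (proj₂ (represents i) on) , unshear-on j x y (proj₂ (represents j) on′)))
      , (λ disj (p , on , on′) → disj (X s p) (proj₂ p)
          (proj₁ (represents i) (shear-on i p on)) (proj₁ (represents j) (shear-on j p on′)))
      where
      gᵤ = generic-shear (λ i → u (C i)) (λ i → u≢0 (C i))
      gᵥ = generic-shear (λ i → v (C i)) (λ i → v≢0 (C i))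
      gₐ = generic-shear (λ i → b (C i) ⊖ a (C i)) (λ i → ⊖-≢-origin (a (C i)) (b (C i)) (a≢b (C i)))
      m = ∃-max (proj₁ gᵤ) (proj₁ gᵥ)
      m′ = ∃-max (proj₁ m) (proj₁ gₐ)
      s : R
      -- One shear serves all chains: `s` exceeds the bounds for first half-lines, last half-lines
      -- and segments.
      s = proj₁ m′ + 1#
      beyond : ∀ {r} → r ≤ proj₁ m′ → r < s
      beyond r≤m′ = ≤-<-trans r≤m′ (x<x+1 _)
      open module S i = Sheared s (C i)
        (proj₂ gᵤ (beyond (≤-trans (proj₁ (proj₂ m)) (proj₁ (proj₂ m′)))) i)
        (proj₂ gᵥ (beyond (≤-trans (proj₁ (proj₂ (proj₂ m))) (proj₁ (proj₂ m′)))) i)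
        (proj₂ gₐ (beyond (proj₁ (proj₂ (proj₂ m′)))) i)
      κ : Fin n → Curve
      κ i = proj₁ (represent (chain i))
      represents : ∀ i → Represents (κ i) (Chain.On (chain i))
      represents i = proj₂ (represent (chain i))

open import Data.Nat using (_+_)

theorem5 : (ℝ : RealField) (n : ℕ) (C : Fin n → Plane.Chain3 ℝ) (ω : ℕ) →
    ¬ HasClique (DisjGraph ℝ C) (suc ω) →
    Colourable (DisjGraph ℝ C) (ω ^ 3 + ω)
theorem5 ℝ n C ω no-clique =
  let κ , same = Shear.curves ℝ C
      -- Cliques are carried back from curves to chains, the colouring is carried over by the other
      -- half of `same`.
      colouring , proper = CurveColouring.curve-colouring ℝ κ ω λ (f , injective , clique) →
        no-clique (f , injective , λ i j i≢j → proj₂ (same (f i) (f j)) (clique i j i≢j))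
  in colouring , λ i j disjoint → proper i j (proj₁ (same i j) disjoint)
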